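{- Let $G$ be a finite simple graph with maximum degree $\Delta\le 5$. If $\mathrm{mad}(G)<2+\frac{12}{29}$, then $\chi_\ell(G^2)\le 6$.
   Context: Graphs are finite and simple. The square $G^2$ of a graph $G$ has vertex set $V(G)$, with two distinct vertices adjacent in $G^2$ iff their distance in $G$ is at most $2$. The maximum average degree is $\mathrm{mad}(G)=\max_{H\subseteq G}\frac{2|E(H)|}{|V(H)|}$, the maximum over all (nonempty) subgraphs $H$ of $G$. A list-assignment $L$ gives each vertex $v$ a set $L(v)$ of colors; an $L$-coloring is a proper coloring in which each vertex $v$ gets a color from $L(v)$. The choice number $\chi_\ell(H)$ of a graph $H$ is the minimum $k$ such that $H$ has an $L$-coloring for every list-assignment $L$ with $|L(v)|\ge k$ for every vertex $v$. -}

module Defs where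

open import Data.Fin.Base using (Fin)
open import Data.Fin.Properties using (any?; _≟_; _<?_)
open import Data.Integer.Base using (+_)
open import Data.List.Base
  using (List; []; _∷_; _++_; map; filter; length; allFin; cartesianProduct)
open import Data.List.Extrema.Nat using () renaming (max to maxℕ)
open import Data.List.Membership.DecPropositional using () renaming (_∈?_ to member?)
open import Data.List.Membership.Propositional using (_∈_)
open import Data.List.Relation.Unary.All using (All; all?)
open import Data.List.Relation.Unary.Unique.Propositional using (Unique)
open import Data.Nat.Base using (ℕ; zero; suc; _*_; _≤_; s≤s; s≤s⁻¹)
open import Data.Nat.Properties using (anyUpTo?)
open import Data.Product.Base using (_×_; _,_; ∃; proj₁; proj₂)
open import Data.Rational.Base using (ℚ; 0ℚ; _/_)
open import Data.Rational.Properties using (≤-decTotalOrder)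
open import Relation.Binary.Bundles using (DecTotalOrder)
open import Relation.Binary.Core using (Rel)
open import Relation.Binary.Definitions using (Decidable; Symmetric; Irreflexive)
open import Relation.Binary.PropositionalEquality using (_≡_; _≢_; refl; sym)
open import Relation.Nullary.Decidable using (Dec; _×-dec_; ¬?; map′)
open import Relation.Unary using () renaming (Decidable to Decidable₁)
open import Level using (0ℓ)

open import Data.List.Extrema (DecTotalOrder.totalOrder ≤-decTotalOrder)
  using () renaming (max to maxℚ)

-- Adjacency is required to be decidable so that degrees and edges can be
-- counted; classically this is no restriction.
record Graph (n : ℕ) : Set₁ where
  field
    Adj    : Rel (Fin n) 0ℓ
    adj?   : Decidable Adj
    symAdj : Symmetric Adj
    irrefl : Irreflexive _≡_ Adj

open Graph public

private
  variable
    n : ℕ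

degree : Graph n → Fin n → ℕ
degree {n} G v = length (filter (adj? G v) (allFin n))

Δ : Graph n → ℕ
Δ {n} G = maxℕ 0 (map (degree G) (allFin n))

-- Every edge is listed once, with its smaller endpoint first.
edges : Graph n → List (Fin n × Fin n)
edges {n} G =
  filter (λ e → (proj₁ e <? proj₂ e) ×-dec adj? G (proj₁ e) (proj₂ e))
         (cartesianProduct (allFin n) (allFin n))

sublists : ∀ {A : Set} → List A → List (List A)
sublists []       = [] ∷ []
sublists (x ∷ xs) = map (x ∷_) (sublists xs) ++ sublists xs

SubgraphData : ℕ → Set
SubgraphData n = List (Fin n) × List (Fin n × Fin n)

Closed : SubgraphData n → Set
Closed (vs , es) = All (λ e → proj₁ e ∈ vs × proj₂ e ∈ vs) es

closed? : Decidable₁ (Closed {n})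
closed? (vs , es) =
  all? (λ e → member? _≟_ (proj₁ e) vs ×-dec member? _≟_ (proj₂ e) vs) es

-- All subgraphs, not only the induced ones.
subgraphs : Graph n → List (SubgraphData n)
subgraphs {n} G =
  filter closed? (cartesianProduct (sublists (allFin n)) (sublists (edges G)))

-- The value for the subgraph without vertices is arbitrary; being 0, it does
-- not affect the maximum in mad over the nonempty subgraphs.
averageDegree : SubgraphData n → ℚ
averageDegree ([]         , es) = 0ℚ
averageDegree (vs@(_ ∷ _) , es) = + (2 * length es) / length vs

-- The base value 0ℚ is only relevant for the graph without vertices.
mad : Graph n → ℚ
mad G = maxℚ 0ℚ (map averageDegree (subgraphs G))

data Walk (G : Graph n) : ℕ → Fin n → Fin n → Set where
  stop : ∀ {u} → Walk G zero u u
  step : ∀ {l u w v} → Adj G u w → Walk G l w v → Walk G (suc l) u v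

-- The distance is the least length of a walk (infinite if there is none), so
-- it is at most d exactly when some walk has length at most d.
DistanceAtMost : Graph n → ℕ → Rel (Fin n) 0ℓ
DistanceAtMost G d u v = ∃ λ l → l ≤ d × Walk G l u v

walk? : ∀ (G : Graph n) l u v → Dec (Walk G l u v)
walk? G zero    u v = map′ (λ { refl → stop }) (λ { stop → refl }) (u ≟ v)
walk? G (suc l) u v =
  map′ (λ { (_ , a , p) → step a p }) (λ { (step a p) → _ , a , p })
       (any? (λ w → adj? G u w ×-dec walk? G l w v))

distanceAtMost? : ∀ (G : Graph n) d → Decidable (DistanceAtMost G d)
distanceAtMost? G d u v =
  map′ (λ { (l , l<1+d , p) → l , s≤s⁻¹ l<1+d , p })
       (λ { (l , l≤d , p) → l , s≤s l≤d , p })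
       (anyUpTo? (λ l → walk? G l u v) (suc d))

snoc : ∀ {G : Graph n} {l u w v} → Walk G l u w → Adj G w v → Walk G (suc l) u v
snoc stop       b = step b stop
snoc (step a p) b = step a (snoc p b)

reverse : ∀ {G : Graph n} {l u v} → Walk G l u v → Walk G l v u
reverse         stop       = stop
reverse {G = G} (step a p) = snoc (reverse p) (symAdj G a)

square : Graph n → Graph n
square G = record
  { Adj    = λ u v → u ≢ v × DistanceAtMost G 2 u v
  ; adj?   = λ u v → ¬? (u ≟ v) ×-dec distanceAtMost? G 2 u v
  ; symAdj = λ { (u≢v , l , l≤2 , p) → (λ v≡u → u≢v (sym v≡u)) , l , l≤2 , reverse p }
  ; irrefl = λ u≡v a → proj₁ a u≡v
  }

-- Colors are natural numbers; the set L(v) is a duplicate-free list.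
LColoring : Graph n → (Fin n → List ℕ) → Set
LColoring {n} H L =
  ∃ λ (c : Fin n → ℕ) → (∀ v → c v ∈ L v) × (∀ {u v} → Adj H u v → c u ≢ c v)

Choosable : Graph n → ℕ → Set
Choosable {n} H k =
  ∀ (L : Fin n → List ℕ) → (∀ v → Unique (L v)) → (∀ v → k ≤ length (L v)) →
  LColoring H L

IsChoiceNumber : Graph n → ℕ → Set
IsChoiceNumber H k = Choosable H k × (∀ j → Choosable H j → k ≤ j)

{-# OPTIONS --safe #-}
-- Induct on the number of edges. Color T greedily at the end, where T is the
-- largest set that allows this: then every vertex outside T has at least 6
-- square-neighbors outside T. An edge uv is irrelevant for the square outside a
-- set U containing u and v, so G - uv can be colored by induction, and a set U
-- that spans an edge must not be extendable; in particular T is independent.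
-- Two further configurations are excluded. First, join two 5-vertices for each
-- thread of three 2-vertices between them, or two 4-vertices for each thread of
-- two 2-vertices: a cycle in this multigraph yields in the square an even cycle
-- of vertices with two available colors each. So there are at most as many such
-- threads as 5-vertices, respectively 4-vertices. Second, a 3-vertex is excluded
-- whose neighbors are all 2-vertices leading to 3-vertices, one of which has only
-- 2-vertices as neighbors. Discharging then shows that the average degree over
-- the non-isolated vertices is at least 2 + 12/29.
module Submission where

open import Defs
open import Data.Bool.Base using (Bool; true; false; if_then_else_)
open import Data.Empty using (⊥)
open import Data.Fin.Base as Fin using (Fin; zero; suc; combine; remQuot; finToFun; funToFin)
import Data.Fin.Properties as Finₚ
open import Data.Fin.Properties using (_≟_; any?; all?)
import Data.Integer.Base as ℤ
open import Data.Integer.Base using (+_)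
import Data.Integer.Properties as ℤₚ
open import Data.List.Base
  using (List; []; _∷_; _++_; map; filter; length; lookup; tabulate; allFin; cartesianProduct; concatMap; upTo)
open import Data.List.Extrema.Nat using () renaming (xs≤max to xs≤maxℕ)
open import Data.List.Membership.Propositional using (_∈_; _∉_; find; lose)
open import Data.List.Membership.Propositional.Properties
open import Data.List.Properties
  using (length-++; length-map; length-filter; filter-notAll; filter-accept; filter-reject; length-tabulate)
open import Data.List.Relation.Unary.All as All using (All; []; _∷_)
import Data.List.Relation.Unary.All.Properties as Allₚ
open import Data.List.Relation.Unary.AllPairs using (AllPairs; []; _∷_)
open import Data.List.Relation.Unary.Any as Any using (Any; here; there)
open import Data.List.Relation.Unary.Unique.Propositional using (Unique)
import Data.List.Relation.Unary.Unique.Propositional.Properties as Unique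
open import Data.Nat.Base
  using (ℕ; zero; suc; _≤_; _^_; ⌊_/2⌋; z≤n; s≤s; s≤s⁻¹)
  renaming (_+_ to _⊹_; _*_ to _·_; _<_ to _≺_)
open import Data.Nat.ListAction using (sum)
import Data.Nat.Properties as ℕ
open import Data.Nat.Solver using (module +-*-Solver)
open import Data.Product.Base using (_×_; _,_; ∃; ∃-syntax; proj₁; proj₂)
open import Data.Product.Properties using (≡-dec)
open import Data.Rational.Base using (_/_; _+_; _<_) renaming (_≤_ to _≤ℚ_)
import Data.Rational.Properties as ℚ
open import Data.Rational.Unnormalised.Base using (mkℚᵘ)
import Data.Rational.Unnormalised.Properties as ℚᵘ
open import Data.Sum.Base using (_⊎_; inj₁; inj₂; [_,_]′)
open import Function.Base using (_∘_; id; case_of_)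
open import Relation.Binary.Bundles using (DecTotalOrder)
open import Relation.Binary.Definitions using (tri<; tri≈; tri>)
open import Relation.Binary.PropositionalEquality
  using (_≡_; _≢_; refl; sym; trans; cong; cong₂; subst; ≢-sym; module ≡-Reasoning)
open import Relation.Nullary.Decidable using (Dec; yes; no; ¬?; _×-dec_; _⊎-dec_; _→-dec_; map′; does; decidable-stable)
open import Relation.Nullary.Negation using (¬_; contradiction)
open import Relation.Unary using () renaming (Decidable to Decidable₁)

open import Data.List.Extrema (DecTotalOrder.totalOrder ℚ.≤-decTotalOrder) using () renaming (xs≤max to xs≤maxℚ)

-- Deleting a vertex could destroy square-adjacencies among its neighbors. So the induction removes
-- only edges, and it applies once the uncolored set contains both ends of an edge, or a leaf. For
-- the same reason the vertices of T stay in the graph: they still link other vertices in the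
-- square, but no longer count as square-neighbors, which makes the demand for six of them outside T
-- harder to meet nearby. The bound is the average degree at which the discharging is exactly
-- balanced. Let each 5-vertex have two threads of three 2-vertices to 5-vertices and three threads
-- of two to 4-vertices, and each 4-vertex two threads of two to 4-vertices and two to 5-vertices.
-- Two 5-vertices and three 4-vertices then go with 24 2-vertices: 29 vertices of total degree 70,
-- and 70/29 = 2 + 12/29. Colorability is obtained under a double negation, as `Critical` assumes
-- its failure. It is recovered because choosing from finite lists is decidable.

private
  variable
    X Y : Set

-- Counting with duplicate-free lists

Unique-⊆-length : {xs ys : List X} → Unique xs → (∀ {x} → x ∈ xs → x ∈ ys) →
                  length xs ≤ length ys
Unique-⊆-length []         sub = z≤n
Unique-⊆-length {xs = x ∷ xs} (x∉xs ∷ u) sub with ∈-∃++ (sub (here refl))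
... | as , bs , refl = begin
    suc (length xs)                ≤⟨ s≤s (Unique-⊆-length u sub′) ⟩
    suc (length (as ++ bs))        ≡⟨ cong suc (length-++ as) ⟩
    suc (length as ⊹ length bs)    ≡⟨ ℕ.+-suc (length as) (length bs) ⟨
    length as ⊹ length (x ∷ bs)    ≡⟨ length-++ as ⟨
    length (as ++ x ∷ bs)          ∎
  where
    open ℕ.≤-Reasoning
    sub′ : ∀ {y} → y ∈ xs → y ∈ as ++ bs
    sub′ y∈xs with ∈-++⁻ as (sub (there y∈xs))
    ... | inj₁ y∈as         = ∈-++⁺ˡ y∈as
    ... | inj₂ (here refl)  = contradiction refl (All.lookup x∉xs y∈xs)
    ... | inj₂ (there y∈bs) = ∈-++⁺ʳ as y∈bs

avoid : List ℕ → List ℕ → List ℕ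
avoid F = filter (λ x → ¬? (member? x F))
  where open import Data.List.Membership.DecPropositional ℕ._≟_ using () renaming (_∈?_ to member?)

avoid-∈ : ∀ {F K x} → x ∈ avoid F K → x ∈ K
avoid-∈ p = proj₁ (∈-filter⁻ _ p)

avoid-∉ : ∀ {F K x} → x ∈ avoid F K → x ∉ F
avoid-∉ {F} {K} p = proj₂ (∈-filter⁻ _ {xs = K} p)

length-avoid : ∀ {K} F → Unique K → length K ≤ length F ⊹ length (avoid F K)
length-avoid {K} F u = begin
    length K                        ≤⟨ Unique-⊆-length u cover ⟩
    length (F ++ avoid F K)         ≡⟨ length-++ F ⟩
    length F ⊹ length (avoid F K)   ∎
  where
    open ℕ.≤-Reasoning
    open import Data.List.Membership.DecPropositional ℕ._≟_ using () renaming (_∈?_ to member?)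
    cover : ∀ {x} → x ∈ K → x ∈ F ++ avoid F K
    cover {x} x∈K with member? x F
    ... | yes x∈F = ∈-++⁺ˡ x∈F
    ... | no  x∉F = ∈-++⁺ʳ F (∈-filter⁺ _ x∈K x∉F)

avoid-unique : ∀ F {K} → Unique K → Unique (avoid F K)
avoid-unique F = Unique.filter⁺ _

pick : ∀ {K} F → Unique K → length F ≺ length K → ∃[ x ] x ∈ K × x ∉ F
pick {K} F u F<K with avoid F K in eq | length-avoid F u
... | []    | K≤ = contradiction (ℕ.≤-trans F<K K≤) (ℕ.<-irrefl (sym (ℕ.+-identityʳ (length F))))
... | x ∷ _ | _  = x , avoid-∈ {F} p , avoid-∉ {F} {K} p
  where p = subst (x ∈_) (sym eq) (here refl)

-- List colorings of a kite and of even cycles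

TwoColors : List ℕ → Set
TwoColors K = ∃[ p ] ∃[ q ] p ∈ K × q ∈ K × p ≢ q

pick-two : ∀ {K} → Unique K → 2 ≤ length K → TwoColors K
pick-two {p ∷ q ∷ _} ((p≢q ∷ _) ∷ _) _ = p , q , here refl , there (here refl) , p≢q
pick-two {_ ∷ []} _ (s≤s ())

∉⇒≢ : ∀ {x a : X} {xs} → x ∉ xs → a ∈ xs → x ≢ a
∉⇒≢ x∉ a∈ refl = x∉ a∈

1st : ∀ {x : X} {xs} → x ∈ x ∷ xs
1st = here refl

2nd : ∀ {x y : X} {xs} → x ∈ y ∷ x ∷ xs
2nd = there 1st

3rd : ∀ {x y z : X} {xs} → x ∈ y ∷ z ∷ x ∷ xs
3rd = there 2nd

-- Colorings of the complete graph on {a₁, x, a₂, a₃} with a further vertex y joined to a₁ and x.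
KiteColoring : (Y A₁ Z A₂ A₃ : List ℕ) → Set
KiteColoring Y A₁ Z A₂ A₃ = ∃[ y ] ∃[ a₁ ] ∃[ x ] ∃[ a₂ ] ∃[ a₃ ]
  (y ∈ Y × a₁ ∈ A₁ × x ∈ Z × a₂ ∈ A₂ × a₃ ∈ A₃) ×
  (y ≢ a₁ × y ≢ x) × (a₁ ≢ x × a₁ ≢ a₂ × a₁ ≢ a₃) × (x ≢ a₂ × x ≢ a₃) × a₂ ≢ a₃

-- Greedy coloring in the order y, x, a₁, a₃, a₂ fails by one color at a₂. A color of A₁ outside A₂,
-- given to a₁, costs a₂ nothing. If there is none, A₂ contains A₁ and so has four colors.
kite-colorable : ∀ {Y A₁ Z A₂ A₃} →
  Unique Y → Unique A₁ → Unique Z → Unique A₂ → Unique A₃ →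
  2 ≤ length Y → 4 ≤ length A₁ → 3 ≤ length Z → 3 ≤ length A₂ → 3 ≤ length A₃ →
  KiteColoring Y A₁ Z A₂ A₃
kite-colorable {Y} {A₁} {Z} {A₂} {A₃} uY uA₁ uZ uA₂ uA₃ lY lA₁ lZ lA₂ lA₃
  with avoid A₂ A₁ in eq
... | z ∷ _ =
  let z∈  = subst (z ∈_) (sym eq) (here refl)
      z∈A₁ = avoid-∈ {A₂} z∈
      z∉A₂ = avoid-∉ {A₂} {A₁} z∈
      y , y∈ , y∉ = pick (z ∷ []) uY lY
      x , x∈ , x∉ = pick (y ∷ z ∷ []) uZ lZ
      c , c∈ , c∉ = pick (z ∷ x ∷ []) uA₃ lA₃
      b , b∈ , b∉ = pick (x ∷ c ∷ []) uA₂ lA₂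
  in y , z , x , b , c , (y∈ , z∈A₁ , x∈ , b∈ , c∈) ,
     (∉⇒≢ y∉ 1st , ≢-sym (∉⇒≢ x∉ 1st)) ,
     (≢-sym (∉⇒≢ x∉ 2nd) , (λ z≡b → z∉A₂ (subst (_∈ A₂) (sym z≡b) b∈)) , ≢-sym (∉⇒≢ c∉ 1st)) ,
     (≢-sym (∉⇒≢ b∉ 1st) , ≢-sym (∉⇒≢ c∉ 2nd)) , ∉⇒≢ b∉ 2nd
... | [] =
  let A₁⊆A₂ : ∀ {c} → c ∈ A₁ → c ∈ A₂
      A₁⊆A₂ {c} c∈ = decidable-stable (c ∈? A₂) λ c∉ → case subst (c ∈_) eq (∈-filter⁺ _ c∈ c∉) of λ ()
      y , y∈ , y∉ = pick [] uY (ℕ.≤-trans (s≤s z≤n) lY)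
      x , x∈ , x∉ = pick (y ∷ []) uZ (ℕ.≤-trans (s≤s (s≤s z≤n)) lZ)
      a , a∈ , a∉ = pick (y ∷ x ∷ []) uA₁ (ℕ.≤-trans (s≤s (s≤s (s≤s z≤n))) lA₁)
      c , c∈ , c∉ = pick (x ∷ a ∷ []) uA₃ lA₃
      b , b∈ , b∉ = pick (x ∷ a ∷ c ∷ []) uA₁ lA₁
  in y , a , x , b , c , (y∈ , a∈ , x∈ , A₁⊆A₂ b∈ , c∈) ,
     (≢-sym (∉⇒≢ a∉ 1st) , ≢-sym (∉⇒≢ x∉ 1st)) ,
     (∉⇒≢ a∉ 2nd , ≢-sym (∉⇒≢ b∉ 2nd) , ≢-sym (∉⇒≢ c∉ 2nd)) ,
     (≢-sym (∉⇒≢ b∉ 1st) , ≢-sym (∉⇒≢ c∉ 1st)) , ∉⇒≢ b∉ 3rd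
  where open import Data.List.Membership.DecPropositional ℕ._≟_ using (_∈?_)

record Chain (P : ℕ → List ℕ) (m s t : ℕ) : Set where
  constructor chain
  field
    z     : ℕ → ℕ
    start : z 0 ≡ s
    end   : z m ≡ t
    z∈    : ∀ {i} → i ≤ m → z i ∈ P i
    z≢    : ∀ {i} → i ≺ m → z i ≢ z (suc i)

chain-single : ∀ {P p} → p ∈ P 0 → Chain P 0 p p
chain-single {p = p} p∈ = chain (λ _ → p) refl refl (λ { z≤n → p∈ }) λ ()

chain-cons : ∀ {P m s t r} → r ∈ P 0 → r ≢ s → Chain (P ∘ suc) m s t → Chain P (suc m) r t
chain-cons {P} {m} {s} {t} {r} r∈ r≢s (chain z z0 zm z∈ z≢) = chain z′ refl zm z′∈ z′≢
  where
    z′ : ℕ → ℕ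
    z′ zero    = r
    z′ (suc i) = z i
    z′∈ : ∀ {i} → i ≤ suc m → z′ i ∈ P i
    z′∈ {zero}  _       = r∈
    z′∈ {suc i} (s≤s l) = z∈ l
    z′≢ : ∀ {i} → i ≺ suc m → z′ i ≢ z′ (suc i)
    z′≢ {zero}  _       = λ eq → r≢s (trans eq z0)
    z′≢ {suc i} (s≤s l) = z≢ l

-- On a path whose lists have two colors, either some final color is compatible
-- with two initial colors (Full), or the two initial colors force the two final
-- ones. In the latter case all lists are equal, and the colors are the same at
-- both ends or swapped, according to the parity of the path.
Full Straight Crossed : (ℕ → List ℕ) → ℕ → Set
Full     P m = ∃[ t ] ∃[ s ] ∃[ s′ ] s ≢ s′ × Chain P m s t × Chain P m s′ t
Straight P m = ∃[ t ] ∃[ t′ ] t ≢ t′ × Chain P m t t × Chain P m t′ t′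
Crossed  P m = ∃[ t ] ∃[ t′ ] t ≢ t′ × Chain P m t t′ × Chain P m t′ t

-- The color r differs from s or from s′, so one of the two chains can be prolonged.
chain-full : ∀ {P m s s′ t r} → r ∈ P 0 → s ≢ s′ →
             Chain (P ∘ suc) m s t → Chain (P ∘ suc) m s′ t → Chain P (suc m) r t
chain-full {s = s} {r = r} r∈ s≢s′ c c′ with r ℕ.≟ s
... | yes refl = chain-cons r∈ s≢s′ c′
... | no  r≢s  = chain-cons r∈ r≢s c

full-step : ∀ {P m} → TwoColors (P 0) → Full (P ∘ suc) m → Full P (suc m)
full-step (p , q , p∈ , q∈ , p≢q) (t , s , s′ , s≢s′ , c , c′) =
  t , p , q , p≢q , chain-full p∈ s≢s′ c c′ , chain-full q∈ s≢s′ c c′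

-- If both new colors avoid s, or both avoid s′, one chain takes them both. Otherwise the new colors
-- are exactly s and s′, and each goes before the chain that starts with the other.
swap-step : ∀ {P m s s′ t t′} → TwoColors (P 0) → s ≢ s′ →
            Chain (P ∘ suc) m s t → Chain (P ∘ suc) m s′ t′ →
            Full P (suc m) ⊎ (Chain P (suc m) s t′ × Chain P (suc m) s′ t)
swap-step {s = s} {s′} {t} {t′} (p , q , p∈ , q∈ , p≢q) s≢s′ c c′
  with p ℕ.≟ s | q ℕ.≟ s | p ℕ.≟ s′ | q ℕ.≟ s′
... | yes refl | yes refl | _ | _ = contradiction refl p≢q
... | no p≢s | no q≢s | _ | _ = inj₁ (t , p , q , p≢q , chain-cons p∈ p≢s c , chain-cons q∈ q≢s c)
... | _ | _ | yes refl | yes refl = contradiction refl p≢q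
... | _ | _ | no p≢s′ | no q≢s′ = inj₁ (t′ , p , q , p≢q , chain-cons p∈ p≢s′ c′ , chain-cons q∈ q≢s′ c′)
... | yes refl | no q≢s | yes refl | _ = contradiction refl s≢s′
... | yes refl | no q≢s | no _ | yes refl = inj₂ (chain-cons p∈ s≢s′ c′ , chain-cons q∈ q≢s c)
... | no p≢s | yes refl | _ | yes refl = contradiction refl s≢s′
... | no p≢s | yes refl | yes refl | no _ = inj₂ (chain-cons q∈ s≢s′ c′ , chain-cons p∈ p≢s c)

chain-even : ∀ k {P} → (∀ {i} → i ≤ k · 2 → TwoColors (P i)) → Full P (k · 2) ⊎ Straight P (k · 2)
chain-odd  : ∀ k {P} → (∀ {i} → i ≤ suc (k · 2) → TwoColors (P i)) →
             Full P (suc (k · 2)) ⊎ Crossed P (suc (k · 2))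

chain-even zero two with two z≤n
... | p , q , p∈ , q∈ , p≢q = inj₂ (p , q , p≢q , chain-single p∈ , chain-single q∈)
chain-even (suc k) two with chain-odd k (λ i≤ → two (s≤s i≤))
... | inj₁ f = inj₁ (full-step (two z≤n) f)
... | inj₂ (t , t′ , t≢t′ , c , c′) with swap-step (two z≤n) t≢t′ c c′
...   | inj₁ f = inj₁ f
...   | inj₂ (d , d′) = inj₂ (t , t′ , t≢t′ , d , d′)
chain-odd k two with chain-even k (λ i≤ → two (s≤s i≤))
... | inj₁ f = inj₁ (full-step (two z≤n) f)
... | inj₂ (t , t′ , t≢t′ , c , c′) with swap-step (two z≤n) t≢t′ c c′
...   | inj₁ f = inj₁ f
...   | inj₂ (d , d′) = inj₂ (t , t′ , t≢t′ , d , d′)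

-- Cut open, the cycle is a path with an odd number of edges, hence full or crossed. Crossing gives
-- different end colors; of two initial colors compatible with the same final color, one differs
-- from it.
even-cycle-colorable : ∀ k {P : ℕ → List ℕ} → (∀ {i} → i ≤ suc (k · 2) → TwoColors (P i)) →
  ∃ λ (z : ℕ → ℕ) → (∀ {i} → i ≤ suc (k · 2) → z i ∈ P i) ×
         (∀ {i} → i ≺ suc (k · 2) → z i ≢ z (suc i)) × z 0 ≢ z (suc (k · 2))
even-cycle-colorable k two with chain-odd k two
... | inj₂ (t , t′ , t≢t′ , chain z refl refl z∈ z≢ , _) = z , z∈ , z≢ , t≢t′
... | inj₁ (t , s , s′ , s≢s′ , chain z z0 zm z∈ z≢ , chain y y0 ym y∈ y≢) with s ℕ.≟ t
...   | no s≢t   = z , z∈ , z≢ , λ e → s≢t (trans (sym z0) (trans e zm))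
...   | yes refl = y , y∈ , y≢ , λ e → s≢s′ (sym (trans (sym y0) (trans e ym)))

-- Neighborhoods, squares and partial colorings

nbrs : ∀ {n} → Graph n → Fin n → List (Fin n)
nbrs {n} G v = filter (adj? G v) (allFin n)

∈-nbrs⁺ : ∀ {n} (G : Graph n) {v u} → Adj G v u → u ∈ nbrs G v
∈-nbrs⁺ G {v} {u} a = ∈-filter⁺ (adj? G v) (∈-allFin u) a

∈-nbrs⁻ : ∀ {n} (G : Graph n) {v u} → u ∈ nbrs G v → Adj G v u
∈-nbrs⁻ {n} G {v} p = proj₂ (∈-filter⁻ (adj? G v) {xs = allFin n} p)

nbrs-unique : ∀ {n} (G : Graph n) v → Unique (nbrs G v)
nbrs-unique {n} G v = Unique.filter⁺ (adj? G v) (Unique.allFin⁺ n)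

square⁻ : ∀ {n} (G : Graph n) {u v} → Adj (square G) u v →
          Adj G u v ⊎ ∃ λ z → Adj G u z × Adj G z v
square⁻ G (u≢v , _ , _ , stop)                  = contradiction refl u≢v
square⁻ G (u≢v , _ , _ , step a stop)           = inj₁ a
square⁻ G (u≢v , _ , _ , step a (step b stop))  = inj₂ (_ , a , b)
square⁻ G (u≢v , _ , s≤s (s≤s ()) , step a (step b (step _ _)))

square⁺¹ : ∀ {n} (G : Graph n) {u v} → u ≢ v → Adj G u v → Adj (square G) u v
square⁺¹ G u≢v a = u≢v , 1 , s≤s z≤n , step a stop

square⁺² : ∀ {n} (G : Graph n) {u z v} → u ≢ v → Adj G u z → Adj G z v → Adj (square G) u v
square⁺² G u≢v a b = u≢v , 2 , ℕ.≤-refl , step a (step b stop)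

module Partial {n : ℕ} (G : Graph n) (L : Fin n → List ℕ) where

  open import Data.List.Membership.DecPropositional (_≟_ {n}) public using (_∈?_)

  H : Graph n
  H = square G

  -- U is the set left uncolored: `c` is total, but its values on U are arbitrary.
  record Coloring (U : List (Fin n)) : Set where
    field
      c  : Fin n → ℕ
      c∈ : ∀ {v} → v ∉ U → c v ∈ L v
      c≢ : ∀ {u v} → u ∉ U → v ∉ U → Adj H u v → c u ≢ c v

  open Coloring public

  outer : List (Fin n) → Fin n → List (Fin n)
  outer U v = filter (λ u → ¬? (u ∈? U)) (nbrs H v)

  ∈-outer⁺ : ∀ {U v u} → u ∉ U → Adj H v u → u ∈ outer U v
  ∈-outer⁺ u∉U a = ∈-filter⁺ _ (∈-nbrs⁺ H a) u∉U

  ∈-outer⁻ : ∀ {U v u} → u ∈ outer U v → u ∉ U × Adj H v u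
  ∈-outer⁻ {U} {v} p with ∈-filter⁻ (λ u → ¬? (u ∈? U)) {xs = nbrs H v} p
  ... | u∈ , u∉U = u∉U , ∈-nbrs⁻ H u∈

  -- Colored square-neighbors are always counted through such a list; repetitions in it only weaken
  -- the bound, so its entries need not be distinguished.
  Covers : List (Fin n) → Fin n → List (Fin n) → Set
  Covers U v ws = ∀ {u} → u ∉ U → Adj H v u → u ∈ ws

  outer-length : ∀ {U v} ws → Covers U v ws → length (outer U v) ≤ length ws
  outer-length {U} {v} ws cov =
    Unique-⊆-length (Unique.filter⁺ _ (nbrs-unique H v))
      (λ p → let q = ∈-outer⁻ {U} {v} p in cov (proj₁ q) (proj₂ q))

  palette : ∀ {U} → Coloring U → Fin n → List ℕ
  palette {U} κ v = avoid (map (c κ) (outer U v)) (L v)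

  palette-∈ : ∀ {U} (κ : Coloring U) {v x} → x ∈ palette κ v → x ∈ L v
  palette-∈ {U} κ {v} = avoid-∈ {map (c κ) (outer U v)}

  palette-≢ : ∀ {U} (κ : Coloring U) {v u x} → x ∈ palette κ v → u ∉ U → Adj H v u → x ≢ c κ u
  palette-≢ {U} κ {v} x∈ u∉U a refl =
    avoid-∉ {map (c κ) (outer U v)} {L v} x∈ (∈-map⁺ (c κ) (∈-outer⁺ u∉U a))

  merge : List (Fin n) → (Fin n → ℕ) → (Fin n → ℕ) → Fin n → ℕ
  merge S d c v = if does (v ∈? S) then d v else c v

  merge-cases : ∀ S d c v → (v ∈ S × merge S d c v ≡ d v) ⊎ (v ∉ S × merge S d c v ≡ c v)
  merge-cases S d c v with v ∈? S
  ... | yes v∈S = inj₁ (v∈S , refl)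
  ... | no  v∉S = inj₂ (v∉S , refl)

  extend : ∀ S {T} (κ : Coloring (S ++ T)) (d : Fin n → ℕ) →
           (∀ {v} → v ∈ S → d v ∈ palette κ v) →
           (∀ {u v} → u ∈ S → v ∈ S → Adj H u v → d u ≢ d v) → Coloring T
  extend S {T} κ d d∈ d≢ = record { c = m ; c∈ = m∈ ; c≢ = m≢ }
    where
      m = merge S d (c κ)
      ∉-both : ∀ {v} → v ∉ S → v ∉ T → v ∉ S ++ T
      ∉-both v∉S v∉T p = [ v∉S , v∉T ]′ (∈-++⁻ S p)
      m∈ : ∀ {v} → v ∉ T → m v ∈ L v
      m∈ {v} v∉T with merge-cases S d (c κ) v
      ... | inj₁ (v∈S , eq) rewrite eq = palette-∈ κ {v} (d∈ v∈S)
      ... | inj₂ (v∉S , eq) rewrite eq = c∈ κ (∉-both v∉S v∉T)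
      m≢ : ∀ {u v} → u ∉ T → v ∉ T → Adj H u v → m u ≢ m v
      m≢ {u} {v} u∉T v∉T a with merge-cases S d (c κ) u | merge-cases S d (c κ) v
      ... | inj₁ (u∈S , e) | inj₁ (v∈S , f) rewrite e | f = d≢ u∈S v∈S a
      ... | inj₁ (u∈S , e) | inj₂ (v∉S , f) rewrite e | f =
        palette-≢ κ {u} (d∈ u∈S) (∉-both v∉S v∉T) a
      ... | inj₂ (u∉S , e) | inj₁ (v∈S , f) rewrite e | f =
        ≢-sym (palette-≢ κ {v} (d∈ v∈S) (∉-both u∉S u∉T) (symAdj H a))
      ... | inj₂ (u∉S , e) | inj₂ (v∉S , f) rewrite e | f =
        c≢ κ (∉-both u∉S u∉T) (∉-both v∉S v∉T) a

  module _ (L-unique : ∀ v → Unique (L v)) (L-length : ∀ v → 6 ≤ length (L v)) where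

    palette-unique : ∀ {U} (κ : Coloring U) v → Unique (palette κ v)
    palette-unique {U} κ v = avoid-unique (map (c κ) (outer U v)) (L-unique v)

    palette-length : ∀ {U} (κ : Coloring U) {v} ws → Covers U v ws →
                     6 ≤ length ws ⊹ length (palette κ v)
    palette-length {U} κ {v} ws cov = begin
        6                                                ≤⟨ L-length v ⟩
        length (L v)                                     ≤⟨ length-avoid F (L-unique v) ⟩
        length F ⊹ length (palette κ v)                  ≡⟨ cong (_⊹ length (palette κ v)) (length-map (c κ) (outer U v)) ⟩
        length (outer U v) ⊹ length (palette κ v)        ≤⟨ ℕ.+-monoˡ-≤ _ (outer-length ws cov) ⟩
        length ws ⊹ length (palette κ v)                 ∎
      where
        open ℕ.≤-Reasoning
        F = map (c κ) (outer U v)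

    greedy : ∀ {T v} → length (outer T v) ≤ 5 → Coloring (v ∷ T) → Coloring T
    greedy {T} {v} few κ with palette κ v in eq
      | palette-length κ {v} (outer T v) (λ u∉ a → ∈-outer⁺ (u∉ ∘ there) a)
    ... | []    | 6≤ = contradiction
      (ℕ.≤-trans 6≤ (ℕ.≤-trans (ℕ.≤-reflexive (ℕ.+-identityʳ _)) few)) λ { (s≤s (s≤s (s≤s (s≤s (s≤s ()))))) }
    ... | x ∷ _ | _  = extend (v ∷ []) κ (λ _ → x)
      (λ { (here refl) → subst (x ∈_) (sym eq) (here refl) })
      (λ { (here refl) (here refl) a → contradiction a (irrefl H refl) })

    Saturated : List (Fin n) → Set
    Saturated T = ∀ {v} → v ∉ T → 6 ≤ length (outer T v)

    -- Adding a vertex with few outer neighbors keeps T uncolorable, because `greedy` would extend a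
    -- coloring. T is duplicate-free, so this stops within n additions; m is the fuel.
    saturate : ∀ m {T} → Unique T → n ≺ m ⊹ length T → ¬ Coloring T →
               ∃ λ T′ → Saturated T′ × ¬ Coloring T′
    saturate zero {T} u n<T _ = contradiction
      (ℕ.<-≤-trans n<T (ℕ.≤-trans (Unique-⊆-length u (λ {x} _ → ∈-allFin x))
        (ℕ.≤-reflexive (length-tabulate id))))
      (ℕ.<-irrefl refl)
    saturate (suc m) {T} u n<m+T ¬κ
      with any? (λ v → ¬? (v ∈? T) ×-dec (length (outer T v) ℕ.≤? 5))
    ... | yes (v , v∉T , few) =
      saturate m {v ∷ T} (All.tabulate (λ { x∈T refl → v∉T x∈T }) ∷ u)
        (subst (n ≺_) (sym (ℕ.+-suc m (length T))) n<m+T) (¬κ ∘ greedy few)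
    ... | no ¬few = T , (λ {v} v∉T → ℕ.≰⇒> λ few → ¬few (v , v∉T , few)) , ¬κ

-- Deleting an edge

module _ {n : ℕ} (G : Graph n) (a b : Fin n) where

  Edge : Fin n → Fin n → Set
  Edge u v = (u ≡ a × v ≡ b) ⊎ (u ≡ b × v ≡ a)

  delete : Graph n
  delete = record
    { Adj    = λ u v → Adj G u v × ¬ Edge u v
    ; adj?   = λ u v → adj? G u v ×-dec
        ¬? ((u ≟ a ×-dec v ≟ b) ⊎-dec (u ≟ b ×-dec v ≟ a))
    ; symAdj = λ { (e , ¬ab) → symAdj G e ,
        [ (λ { (p , q) → ¬ab (inj₂ (q , p)) }) , (λ { (p , q) → ¬ab (inj₁ (q , p)) }) ]′ }
    ; irrefl = λ eq e → irrefl G eq (proj₁ e)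
    }

  -- A path of length at most 2 between vertices outside U contains neither an
  -- edge inside U nor an edge at a leaf in U.
  restore : ∀ {L U} → a ∈ U → b ∈ U ⊎ (∀ {z} → Adj G a z → z ≡ b) →
            LColoring (square delete) L → Partial.Coloring G L U
  restore {L} {U} a∈U b∈U⊎leaf (c , c∈ , c≢) = record
    { c = c ; c∈ = λ {v} _ → c∈ v ; c≢ = λ u∉U v∉U e → c≢ (transfer u∉U v∉U e) }
    where
      keep : ∀ {x z} → x ≢ a → x ≢ b ⊎ z ≢ a → Adj G x z → Adj delete x z
      keep x≢a or e = e , λ
        { (inj₁ (x≡a , _))   → x≢a x≡a
        ; (inj₂ (x≡b , z≡a)) → [ (λ x≢b → x≢b x≡b) , (λ z≢a → z≢a z≡a) ]′ or }
      transfer : ∀ {u v} → u ∉ U → v ∉ U → Adj (square G) u v → Adj (square delete) u v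
      transfer {u} {v} u∉U v∉U uv@(u≢v , _) with square⁻ G uv
      ... | inj₁ e = square⁺¹ delete u≢v (keep (λ { refl → u∉U a∈U }) (inj₂ λ { refl → v∉U a∈U }) e)
      ... | inj₂ (z , e , f) = square⁺² delete u≢v
              (keep (λ { refl → u∉U a∈U }) (side b∈U⊎leaf u∉U e f u≢v) e)
              (symAdj delete (keep (λ { refl → v∉U a∈U })
                (side b∈U⊎leaf v∉U (symAdj G f) (symAdj G e) (≢-sym u≢v)) (symAdj G f)))
        where
          side : ∀ {x y} → b ∈ U ⊎ (∀ {z} → Adj G a z → z ≡ b) → x ∉ U → Adj G x z → Adj G z y → x ≢ y → x ≢ b ⊎ z ≢ a
          side split x∉U e f x≢y with z ≟ a
          side split        x∉U e f x≢y | no z≢a   = inj₂ z≢a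
          side (inj₁ b∈U)   x∉U e f x≢y | yes refl = inj₁ λ { refl → x∉U b∈U }
          side (inj₂ leaf)  x∉U e f x≢y | yes refl =
            contradiction (trans (leaf (symAdj G e)) (sym (leaf f))) x≢y

-- Sums, removal from lists, and the second neighbor of a 2-vertex

∑ : List X → (X → ℕ) → ℕ
∑ xs f = sum (map f xs)

length-concatMap : (f : X → List Y) (xs : List X) → length (concatMap f xs) ≡ ∑ xs (length ∘ f)
length-concatMap f []       = refl
length-concatMap f (x ∷ xs) = trans (length-++ (f x)) (cong (length (f x) ⊹_) (length-concatMap f xs))

remove : ∀ {n} → Fin n → List (Fin n) → List (Fin n)
remove v = filter (λ z → ¬? (z ≟ v))

∈-remove⁺ : ∀ {n} {v z : Fin n} {xs} → z ∈ xs → z ≢ v → z ∈ remove v xs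
∈-remove⁺ {v = v} = ∈-filter⁺ (λ z → ¬? (z ≟ v))

∈-remove⁻ : ∀ {n} {v z : Fin n} {xs} → z ∈ remove v xs → z ∈ xs × z ≢ v
∈-remove⁻ {v = v} = ∈-filter⁻ (λ z → ¬? (z ≟ v))

length-remove : ∀ {n} {v : Fin n} {xs} → v ∈ xs → length (remove v xs) ≺ length xs
length-remove {v = v} {xs} v∈ =
  filter-notAll (λ z → ¬? (z ≟ v)) xs (Any.map (λ { refl ¬≡ → ¬≡ refl }) v∈)

module _ {n : ℕ} (G : Graph n) where

  first : Fin n → List (Fin n) → Fin n
  first v []      = v
  first v (x ∷ _) = x

  -- The second neighbor of a 2-vertex v with neighbor u; meaningless otherwise.
  other : Fin n → Fin n → Fin n
  other v u = first v (remove u (nbrs G v))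

  record Other (v u s : Fin n) : Set where
    field
      adj   : Adj G v s
      s≢u   : s ≢ u
      cover : ∀ {z} → Adj G v z → z ≡ u ⊎ z ≡ s

  other-spec : ∀ {v u} → degree G v ≡ 2 → Adj G v u → Other v u (other v u)
  other-spec {v} {u} d a with nbrs G v in eq | nbrs-unique G v
  other-spec {v} {u} refl a | p ∷ q ∷ [] | (p≢q ∷ []) ∷ _ = goal (p ≟ u) (q ≟ u)
    where
      q∈ : q ∈ nbrs G v
      q∈ = subst (q ∈_) (sym eq) 2nd
      p∈ : p ∈ nbrs G v
      p∈ = subst (p ∈_) (sym eq) 1st
      mem : ∀ {z} → Adj G v z → z ≡ p ⊎ z ≡ q
      mem {z} vz with subst (z ∈_) eq (∈-nbrs⁺ G vz)
      ... | here z≡p         = inj₁ z≡p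
      ... | there (here z≡q) = inj₂ z≡q
      goal : (p? : Dec (p ≡ u)) (q? : Dec (q ≡ u)) → Other v u (first v (remove u (p ∷ q ∷ [])))
      goal (yes refl) (yes refl) = contradiction refl p≢q
      goal (yes refl) (no q≢u)
        rewrite filter-reject (λ z → ¬? (z ≟ u)) {xs = q ∷ []} (λ ¬≡ → ¬≡ refl)
              | filter-accept (λ z → ¬? (z ≟ u)) {xs = []} q≢u =
        record { adj = ∈-nbrs⁻ G q∈ ; s≢u = q≢u ; cover = mem }
      goal (no p≢u) _
        rewrite filter-accept (λ z → ¬? (z ≟ u)) {xs = q ∷ []} p≢u = record
        { adj = ∈-nbrs⁻ G p∈ ; s≢u = p≢u
        ; cover = λ {z} vz → [ (λ z≡p → inj₂ z≡p) , (λ z≡q → inj₁ (trans z≡q q≡u)) ]′ (mem vz) }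
        where
          q≡u : q ≡ u
          q≡u = [ (λ u≡p → contradiction (sym u≡p) p≢u) , sym ]′ (mem a)

  module _ {v u : Fin n} (d : degree G v ≡ 2) (a : Adj G v u) where

    open Other (other-spec d a) public renaming (adj to other-adj; s≢u to other-≢; cover to other-cover)

    other-unique : ∀ {s} → Adj G v s → s ≢ u → other v u ≡ s
    other-unique b s≢u = [ (λ s≡u → contradiction s≡u s≢u) , sym ]′ (other-cover b)

  other-other : ∀ {v u} → degree G v ≡ 2 → Adj G v u → other v (other v u) ≡ u
  other-other d a = other-unique d (other-adj d a) a (≢-sym (other-≢ d a))

-- A counterexample all of whose subgraphs obtained by deleting an edge are
-- colorable. T is a set of vertices that can be colored greedily at the end;
-- its complement induces minimum degree at least 6 in the square.
record Critical {n : ℕ} (G : Graph n) : Set where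
  field
    L : Fin n → List ℕ
    T : List (Fin n)

  open Partial G L public

  field
    L-unique      : ∀ v → Unique (L v)
    L-length      : ∀ v → 6 ≤ length (L v)
    degree≤5      : ∀ v → degree G v ≤ 5
    degree≢1      : ∀ v → degree G v ≢ 1
    saturated     : ∀ {v} → v ∉ T → 6 ≤ length (outer T v)
    independent   : ∀ {u v} → u ∈ T → v ∈ T → ¬ Adj G u v
    inside        : ∀ U {u v} → u ∈ U → v ∈ U → Adj G u v → ¬ ¬ Coloring U
    uncolorable   : ¬ Coloring []
    T-uncolorable : ¬ Coloring T

-- Degree conditions and threads in a critical graph

module Structure {n : ℕ} {G : Graph n} (critical : Critical G) where

  open Critical critical public

  deg : Fin n → ℕ
  deg = degree G

  -- What the neighbor u contributes to the square-neighborhood of v outside T.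
  Φ : Fin n → Fin n → List (Fin n)
  Φ v u = filter (λ z → ¬? (z ∈? T)) (remove v (u ∷ nbrs G u))

  φ : Fin n → Fin n → ℕ
  φ v u = length (Φ v u)

  ∈-Φ⁺ : ∀ {v u z} → z ∈ u ∷ nbrs G u → z ≢ v → z ∉ T → z ∈ Φ v u
  ∈-Φ⁺ {v} {u} z∈ z≢v z∉T =
    ∈-filter⁺ (λ z → ¬? (z ∈? T)) (∈-remove⁺ {v = v} {xs = u ∷ nbrs G u} z∈ z≢v) z∉T

  -- The closed neighborhood of u has deg u + 1 elements, and v is one of them.
  φ-≤ : ∀ {v u} → Adj G v u → φ v u ≤ deg u
  φ-≤ {v} {u} a = ℕ.≤-trans (length-filter _ (remove v (u ∷ nbrs G u)))
    (s≤s⁻¹ (length-remove {xs = u ∷ nbrs G u} (there (∈-nbrs⁺ G (symAdj G a)))))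

  φ-< : ∀ {v u z} → Adj G v u → v ∉ T → z ∈ T → z ∈ u ∷ nbrs G u → φ v u ≺ deg u
  φ-< {v} {u} {z} a v∉T z∈T z∈ = ℕ.<-≤-trans
    (filter-notAll _ (remove v (u ∷ nbrs G u))
      (Any.map (λ { refl z∉T → z∉T z∈T }) (∈-remove⁺ z∈ λ { refl → v∉T z∈T })))
    (s≤s⁻¹ (length-remove {xs = u ∷ nbrs G u} (there (∈-nbrs⁺ G (symAdj G a)))))

  Φ-cover : ∀ {v z} → z ∉ T → Adj H v z → ∃ λ u → Adj G v u × z ∈ Φ v u
  Φ-cover {v} {z} z∉T vz@(v≢z , _) with square⁻ G vz
  ... | inj₁ a           = z , a , ∈-Φ⁺ (here refl) (≢-sym v≢z) z∉T
  ... | inj₂ (u , a , b) = u , a , ∈-Φ⁺ (there (∈-nbrs⁺ G b)) (≢-sym v≢z) z∉T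

  -- The contributions `Φ v u` cover all square-neighbors of v outside T. Together with `φ-≤` and
  -- `φ-<` this turns saturation into conditions on degrees.
  φ-sum : ∀ {v} → v ∉ T → 6 ≤ ∑ (nbrs G v) (φ v)
  φ-sum {v} v∉T = ℕ.≤-trans (saturated v∉T)
    (ℕ.≤-trans (outer-length (concatMap (Φ v) (nbrs G v)) cov) (ℕ.≤-reflexive (length-concatMap (Φ v) (nbrs G v))))
    where
      cov : Covers T v (concatMap (Φ v) (nbrs G v))
      cov z∉T vz with Φ-cover z∉T vz
      ... | u , a , z∈ = ∈-concatMap⁺ (Φ v) (Any.map (λ { refl → z∈ }) (∈-nbrs⁺ G a))

  φ-two : ∀ {v u} → deg v ≡ 2 → Adj G v u → v ∉ T → 6 ≤ φ v u ⊹ φ v (other G v u)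
  φ-two {v} {u} d a v∉T = ℕ.≤-trans (saturated v∉T)
    (ℕ.≤-trans (outer-length (Φ v u ++ Φ v (other G v u)) cov) (ℕ.≤-reflexive (length-++ (Φ v u))))
    where
      cov : Covers T v (Φ v u ++ Φ v (other G v u))
      cov z∉T vz with Φ-cover z∉T vz
      ... | w , b , z∈ with other-cover G d a b
      ...   | inj₁ refl = ∈-++⁺ˡ z∈
      ...   | inj₂ refl = ∈-++⁺ʳ (Φ v u) z∈

  module _ {v s : Fin n} (dv : deg v ≡ 2) (ds : deg s ≡ 2) (vs : Adj G v s) (v∉T : v ∉ T) where

    -- The 2-vertex s contributes at most two of the six square-neighbors.
    outer-≥4 : 4 ≤ deg (other G v s)
    outer-≥4 = ℕ.+-cancelˡ-≤ 2 4 (deg (other G v s)) (ℕ.≤-trans (φ-two dv vs v∉T)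
      (ℕ.+-mono-≤ (ℕ.≤-trans (φ-≤ vs) (ℕ.≤-reflexive ds)) (φ-≤ (other-adj G dv vs))))

    -- As s itself does not count, it contributes at most one, and five are left to the other
    -- neighbor.
    outer-≡5 : s ∈ T → deg (other G v s) ≡ 5
    outer-≡5 s∈T = ℕ.≤-antisym (degree≤5 _) (ℕ.+-cancelˡ-≤ 1 5 (deg (other G v s)) (ℕ.≤-trans (φ-two dv vs v∉T)
      (ℕ.+-mono-≤ (s≤s⁻¹ (ℕ.≤-trans (φ-< vs v∉T s∈T (here refl)) (ℕ.≤-reflexive ds)))
                  (φ-≤ (other-adj G dv vs)))))

  middle-∈T : ∀ {v s} → deg v ≡ 2 → deg s ≡ 2 → Adj G v s → deg (other G v s) ≡ 2 → v ∈ T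
  middle-∈T {v} dv ds vs du = decidable-stable (v ∈? T) λ v∉T →
    contradiction (ℕ.≤-trans (outer-≥4 dv ds vs v∉T) (ℕ.≤-reflexive du)) λ { (s≤s (s≤s ())) }

  -- Ends (w , a) of threads: a 2-vertex a next to a vertex w of degree at least 4.
  -- The partner of an end is the other end of its thread.
  record EndSystem : Set₁ where
    field
      End     : Fin n × Fin n → Set
      End?    : Decidable₁ End
      π       : Fin n × Fin n → Fin n × Fin n
      π-End   : ∀ {e} → End e → End (π e)
      ππ      : ∀ {e} → End e → π (π e) ≡ e
      π-≢     : ∀ {e} → End e → proj₁ (π e) ≢ proj₁ e
      near    : ∀ {e f} → End e → End f → Adj H (proj₂ e) (proj₂ f) → f ≡ π e ⊎ proj₁ e ≡ proj₁ f
      covered : ∀ {e f} → End e → End f → proj₁ f ≡ proj₁ e → f ≢ e →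
                ∃ λ ws → length ws ≤ 4 ×
                  (∀ {u} → u ∉ T → u ≢ proj₂ (π e) → u ≢ proj₂ f → Adj H (proj₂ e) u → u ∈ ws)
      inner   : ∀ {e} → End e → ∃ λ z → Adj G (proj₂ e) z × (z ∈ T ⊎ z ≡ proj₂ (π e))

  -- The other hub of the thread is not mentioned in End₅: it has degree 5 because
  -- the middle vertex of the thread is in T.
  End₅ : Fin n × Fin n → Set
  End₅ (w , a) = Adj G w a × deg w ≡ 5 × deg a ≡ 2 × deg t ≡ 2 × deg (other G t a) ≡ 2
    where t = other G a w

  End₄ : Fin n × Fin n → Set
  End₄ (w , a) = Adj G w a × deg w ≡ 4 × deg a ≡ 2 × deg b ≡ 2 × deg (other G b a) ≡ 4
    where b = other G a w

  End₅? : Decidable₁ End₅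
  End₅? (w , a) = adj? G w a ×-dec deg w ℕ.≟ 5 ×-dec deg a ℕ.≟ 2 ×-dec _ ℕ.≟ 2 ×-dec _ ℕ.≟ 2

  End₄? : Decidable₁ End₄
  End₄? (w , a) = adj? G w a ×-dec deg w ℕ.≟ 4 ×-dec deg a ℕ.≟ 2 ×-dec _ ℕ.≟ 2 ×-dec _ ℕ.≟ 4

  deg-≢ : ∀ {u v k l} → deg u ≡ k → deg v ≡ l → k ≢ l → u ≢ v
  deg-≢ du dv k≢l refl = k≢l (trans (sym du) dv)

  -- The thread is w, a, t, b, w′ in this order, and t is its vertex in T.
  module Thread₅ {w a : Fin n} (e : End₅ (w , a)) where

    t = other G a w
    b = other G t a
    w′ = other G b t

    wa = proj₁ e
    dw = proj₁ (proj₂ e)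
    da = proj₁ (proj₂ (proj₂ e))
    dt = proj₁ (proj₂ (proj₂ (proj₂ e)))
    db = proj₂ (proj₂ (proj₂ (proj₂ e)))

    aw = symAdj G wa
    at = other-adj G da aw
    ta = symAdj G at
    tb = other-adj G dt ta
    bt = symAdj G tb
    bw′ = other-adj G db bt
    b≢a = other-≢ G dt ta

    t∈T : t ∈ T
    t∈T = middle-∈T dt da ta db

    a∉T : a ∉ T
    a∉T a∈T = independent a∈T t∈T at

    b∉T : b ∉ T
    b∉T b∈T = independent b∈T t∈T bt

    dw′ : deg w′ ≡ 5
    dw′ = outer-≡5 db dt bt b∉T t∈T

    other-b : other G b w′ ≡ t
    other-b = other-other G db bt

    other-t : other G t b ≡ a
    other-t = other-other G dt ta

    partner-end : End₅ (w′ , b)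
    partner-end = symAdj G bw′ , dw′ , db , trans (cong deg other-b) dt ,
      trans (cong deg (trans (cong (λ x → other G x b) other-b) other-t)) da

    partner-partner : let t′ = other G b w′ ; b′ = other G t′ b in (other G b′ t′ , b′) ≡ (w , a)
    partner-partner rewrite other-b | other-t | other-other G da aw = refl

    square-nbr : ∀ {u} → u ∉ T → Adj H a u → u ≡ w ⊎ (u ≢ a × Adj G w u) ⊎ u ≡ b
    square-nbr u∉T au@(a≢u , _) with square⁻ G au
    ... | inj₁ x with other-cover G da aw x
    ...   | inj₁ u≡w  = inj₁ u≡w
    ...   | inj₂ refl = contradiction t∈T u∉T
    square-nbr u∉T au@(a≢u , _) | inj₂ (z , x , y) with other-cover G da aw x
    ... | inj₁ refl = inj₂ (inj₁ (≢-sym a≢u , y))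
    ... | inj₂ refl with other-cover G dt ta y
    ...   | inj₁ u≡a = contradiction (sym u≡a) a≢u
    ...   | inj₂ u≡b = inj₂ (inj₂ u≡b)

    -- In a thread closed at w, also b is a neighbor of w. Then a has only w and the four other
    -- neighbors of w as square-neighbors outside T.
    w′≢w : w′ ≢ w
    w′≢w w′≡w = contradiction
      (ℕ.≤-trans (saturated a∉T) (ℕ.≤-trans (outer-length (w ∷ remove a (nbrs G w)) cov)
        (ℕ.≤-trans (length-remove (∈-nbrs⁺ G wa)) (ℕ.≤-reflexive dw))))
      λ { (s≤s (s≤s (s≤s (s≤s (s≤s ()))))) }
      where
        cov : Covers T a (w ∷ remove a (nbrs G w))
        cov u∉T au with square-nbr u∉T au
        ... | inj₁ refl               = here refl
        ... | inj₂ (inj₁ (u≢a , wu))  = there (∈-remove⁺ (∈-nbrs⁺ G wu) u≢a)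
        ... | inj₂ (inj₂ refl)        = there (∈-remove⁺
              (∈-nbrs⁺ G (subst (λ x → Adj G x b) w′≡w (symAdj G bw′))) b≢a)

  ends₅ : EndSystem
  ends₅ = record
    { End     = End₅
    ; End?    = End₅?
    ; π       = λ { (w , a) → let t = other G a w ; b = other G t a in other G b t , b }
    ; π-End   = λ e → Thread₅.partner-end e
    ; ππ      = λ e → Thread₅.partner-partner e
    ; π-≢     = λ e → Thread₅.w′≢w e
    ; near    = near
    ; covered = covered
    ; inner   = λ e → let open Thread₅ e in t , at , inj₁ t∈T
    }
    where
      near : ∀ {e f} → End₅ e → End₅ f → Adj H (proj₂ e) (proj₂ f) → _
      near {w , a} {x , a′} e f aa′ with Thread₅.square-nbr e (Thread₅.a∉T f) aa′
      ... | inj₁ a′≡w = contradiction a′≡w (deg-≢ (Thread₅.da f) (Thread₅.dw e) λ ())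
      ... | inj₂ (inj₁ (_ , wa′)) with other-cover G (Thread₅.da f) (Thread₅.aw f) (symAdj G wa′)
      ...   | inj₁ w≡x = inj₂ w≡x
      ...   | inj₂ w≡t = contradiction w≡t (deg-≢ (Thread₅.dw e) (Thread₅.dt f) λ ())
      near {w , a} {x , a′} e f aa′ | inj₂ (inj₂ refl)
        with other-cover G (Thread₅.db e) (Thread₅.bt e) (Thread₅.aw f)
      ... | inj₁ x≡t  = contradiction x≡t (deg-≢ (Thread₅.dw f) (Thread₅.dt e) λ ())
      ... | inj₂ refl = inj₁ refl
      covered : ∀ {e f} → End₅ e → End₅ f → proj₁ f ≡ proj₁ e → f ≢ e → _
      covered {w , a} {.w , c} e f refl f≢e = ws , ws≤4 , λ {u} → cov {u}
        where
          open Thread₅ e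
          -- Besides b and c there remain w and the other three of its five neighbors.
          ws = w ∷ remove c (remove a (nbrs G w))
          c≢a : c ≢ a
          c≢a refl = f≢e refl
          ws≤4 : length ws ≤ 4
          ws≤4 = ℕ.≤-trans (length-remove (∈-remove⁺ (∈-nbrs⁺ G (Thread₅.wa f)) c≢a))
            (s≤s⁻¹ (ℕ.≤-trans (length-remove (∈-nbrs⁺ G wa)) (ℕ.≤-reflexive dw)))
          cov : ∀ {u} → u ∉ T → u ≢ b → u ≢ c → Adj H a u → u ∈ ws
          cov u∉T u≢b u≢c au with square-nbr u∉T au
          ... | inj₁ refl              = here refl
          ... | inj₂ (inj₁ (u≢a , wu)) = there (∈-remove⁺ (∈-remove⁺ (∈-nbrs⁺ G wu) u≢a) u≢c)
          ... | inj₂ (inj₂ refl)       = contradiction refl u≢b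

  -- The thread is w, a, b, w′ in this order.
  module Thread₄ {w a : Fin n} (e : End₄ (w , a)) where

    b = other G a w
    w′ = other G b a

    wa = proj₁ e
    dw = proj₁ (proj₂ e)
    da = proj₁ (proj₂ (proj₂ e))
    db = proj₁ (proj₂ (proj₂ (proj₂ e)))
    dw′ = proj₂ (proj₂ (proj₂ (proj₂ e)))

    aw = symAdj G wa
    ab = other-adj G da aw
    ba = symAdj G ab
    bw′ = other-adj G db ba

    other-a : other G a b ≡ w
    other-a = other-other G da aw

    other-b : other G b w′ ≡ a
    other-b = other-other G db ba

    a∉T : a ∉ T
    a∉T a∈T = contradiction (trans (sym dw′)
      (outer-≡5 db da ba (λ b∈T → independent a∈T b∈T ab) a∈T)) λ ()

    partner-end : End₄ (w′ , b)
    partner-end = symAdj G bw′ , dw′ , db , trans (cong deg other-b) da ,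
      trans (cong deg (trans (cong (λ x → other G x b) other-b) other-a)) dw

    partner-partner : let a′ = other G b w′ in (other G a′ b , a′) ≡ (w , a)
    partner-partner rewrite other-b | other-a = refl

    square-nbr : ∀ {u} → Adj H a u → u ≡ w ⊎ (u ≢ a × Adj G w u) ⊎ u ≡ b ⊎ u ≡ w′
    square-nbr au@(a≢u , _) with square⁻ G au
    ... | inj₁ x with other-cover G da aw x
    ...   | inj₁ u≡w = inj₁ u≡w
    ...   | inj₂ u≡b = inj₂ (inj₂ (inj₁ u≡b))
    square-nbr au@(a≢u , _) | inj₂ (z , x , y) with other-cover G da aw x
    ... | inj₁ refl = inj₂ (inj₁ (≢-sym a≢u , y))
    ... | inj₂ refl with other-cover G db ba y
    ...   | inj₁ u≡a  = contradiction (sym u≡a) a≢u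
    ...   | inj₂ u≡w′ = inj₂ (inj₂ (inj₂ u≡w′))

    w′≢w : w′ ≢ w
    w′≢w w′≡w = contradiction
      (ℕ.≤-trans (saturated a∉T) (ℕ.≤-trans (outer-length (w ∷ remove a (nbrs G w)) cov)
        (ℕ.≤-trans (length-remove (∈-nbrs⁺ G wa)) (ℕ.≤-reflexive dw))))
      λ { (s≤s (s≤s (s≤s (s≤s ())))) }
      where
        cov : Covers T a (w ∷ remove a (nbrs G w))
        cov _ au with square-nbr au
        ... | inj₁ refl                     = here refl
        ... | inj₂ (inj₁ (u≢a , wu))        = there (∈-remove⁺ (∈-nbrs⁺ G wu) u≢a)
        ... | inj₂ (inj₂ (inj₁ refl))       = there (∈-remove⁺
              (∈-nbrs⁺ G (subst (λ x → Adj G x b) w′≡w (symAdj G bw′))) λ { b≡a → irrefl G (sym b≡a) ab })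
        ... | inj₂ (inj₂ (inj₂ u≡w′))       = here (trans u≡w′ w′≡w)

  ends₄ : EndSystem
  ends₄ = record
    { End     = End₄
    ; End?    = End₄?
    ; π       = λ { (w , a) → let b = other G a w in other G b a , b }
    ; π-End   = λ e → Thread₄.partner-end e
    ; ππ      = λ e → Thread₄.partner-partner e
    ; π-≢     = λ e → Thread₄.w′≢w e
    ; near    = near
    ; covered = covered
    ; inner   = λ e → let open Thread₄ e in b , ab , inj₂ refl
    }
    where
      near : ∀ {e f} → End₄ e → End₄ f → Adj H (proj₂ e) (proj₂ f) → _
      near {w , a} {x , a′} e f aa′ with Thread₄.square-nbr e aa′
      ... | inj₁ a′≡w = contradiction a′≡w (deg-≢ (Thread₄.da f) (Thread₄.dw e) λ ())
      ... | inj₂ (inj₁ (_ , wa′)) with other-cover G (Thread₄.da f) (Thread₄.aw f) (symAdj G wa′)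
      ...   | inj₁ w≡x = inj₂ w≡x
      ...   | inj₂ w≡b = contradiction w≡b (deg-≢ (Thread₄.dw e) (Thread₄.db f) λ ())
      near {w , a} {x , a′} e f aa′ | inj₂ (inj₂ (inj₁ refl))
        with other-cover G (Thread₄.db e) (Thread₄.ba e) (Thread₄.aw f)
      ... | inj₁ x≡a  = contradiction x≡a (deg-≢ (Thread₄.dw f) (Thread₄.da e) λ ())
      ... | inj₂ refl = inj₁ refl
      near {w , a} {x , a′} e f aa′ | inj₂ (inj₂ (inj₂ a′≡w′)) =
        contradiction a′≡w′ (deg-≢ (Thread₄.da f) (Thread₄.dw′ e) λ ())
      covered : ∀ {e f} → End₄ e → End₄ f → proj₁ f ≡ proj₁ e → f ≢ e → _
      covered {w , a} {.w , c} e f refl f≢e = ws , ws≤4 , λ {u} → cov {u}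
        where
          open Thread₄ e
          -- The thread is shorter, so w′ counts too, but w has only two neighbors besides a and c.
          ws = w ∷ w′ ∷ remove c (remove a (nbrs G w))
          c≢a : c ≢ a
          c≢a refl = f≢e refl
          ws≤4 : length ws ≤ 4
          ws≤4 = s≤s (ℕ.≤-trans (length-remove (∈-remove⁺ (∈-nbrs⁺ G (Thread₄.wa f)) c≢a))
            (s≤s⁻¹ (ℕ.≤-trans (length-remove (∈-nbrs⁺ G wa)) (ℕ.≤-reflexive dw))))
          cov : ∀ {u} → u ∉ T → u ≢ b → u ≢ c → Adj H a u → u ∈ ws
          cov _ u≢b u≢c au with square-nbr au
          ... | inj₁ refl                     = here refl
          ... | inj₂ (inj₁ (u≢a , wu))        =
            there (there (∈-remove⁺ (∈-remove⁺ (∈-nbrs⁺ G wu) u≢a) u≢c))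
          ... | inj₂ (inj₂ (inj₁ refl))       = contradiction refl u≢b
          ... | inj₂ (inj₂ (inj₂ refl))       = there (here refl)

-- The excluded configuration at a 3-vertex

assign : ∀ {n} → List (Fin n × ℕ) → Fin n → ℕ
assign []            v = 0
assign ((k , c) ∷ ρ) v = if does (v ≟ k) then c else assign ρ v

assign-∈ : ∀ {n} {ρ : List (Fin n × ℕ)} {k c} → Unique (map proj₁ ρ) → (k , c) ∈ ρ → assign ρ k ≡ c
assign-∈ {k = k} _ (here refl) with k ≟ k
... | yes _  = refl
... | no k≢k = contradiction refl k≢k
assign-∈ {ρ = (k′ , _) ∷ ρ} {k = k} (k′∉ ∷ u) (there p) with k ≟ k′
... | no _     = assign-∈ u p
... | yes refl = contradiction refl (All.lookup k′∉ (∈-map⁺ proj₁ p))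

length-remove-unique : ∀ {n} {v : Fin n} {xs} → Unique xs → length xs ≤ suc (length (remove v xs))
length-remove-unique {v = v} {xs} u = Unique-⊆-length u cov
  where
    cov : ∀ {z} → z ∈ xs → z ∈ v ∷ remove v xs
    cov {z} z∈ with z ≟ v
    ... | yes refl = here refl
    ... | no z≢v   = there (∈-remove⁺ z∈ z≢v)

even : ℕ → Bool
even zero          = true
even (suc zero)    = false
even (suc (suc i)) = even i

even-double : ∀ k → even (k · 2) ≡ true
even-double zero    = refl
even-double (suc k) = even-double k

odd-double : ∀ k → even (suc (k · 2)) ≡ false
odd-double zero    = refl
odd-double (suc k) = odd-double k

half-double : ∀ k → ⌊ k · 2 /2⌋ ≡ k
half-double zero    = refl
half-double (suc k) = cong suc (half-double k)

half-odd : ∀ k → ⌊ suc (k · 2) /2⌋ ≡ k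
half-odd zero    = refl
half-odd (suc k) = cong suc (half-odd k)

parity : ∀ i → (∃ λ k → i ≡ k · 2) ⊎ (∃ λ k → i ≡ suc (k · 2))
parity zero       = inj₁ (0 , refl)
parity (suc zero) = inj₂ (0 , refl)
parity (suc (suc i)) with parity i
... | inj₁ (k , refl) = inj₁ (suc k , refl)
... | inj₂ (k , refl) = inj₂ (suc k , refl)

double-≤ : ∀ {k m} → k · 2 ≤ suc (m · 2) → k ≤ m
double-≤ {zero}          _             = z≤n
double-≤ {suc k} {suc m} (s≤s (s≤s l)) = s≤s (double-≤ l)
double-≤ {suc k} {zero}  (s≤s ())

module Reducible {n : ℕ} {G : Graph n} (critical : Critical G) where

  open Structure critical

  palette-≥ : ∀ {U} (κ : Coloring U) v k ws → length ws ⊹ k ≤ 6 → Covers U v ws → k ≤ length (palette κ v)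
  palette-≥ κ v k ws k≤ cov = ℕ.+-cancelˡ-≤ (length ws) k _
    (ℕ.≤-trans k≤ (palette-length L-unique L-length κ ws cov))

  Tight : Fin n → Set
  Tight x = deg x ≡ 3 × All (λ v → deg v ≡ 2 × deg (other G v x) ≡ 3) (nbrs G x)

  Tight? : Decidable₁ Tight
  Tight? x = deg x ℕ.≟ 3 ×-dec All.all? (λ v → deg v ℕ.≟ 2 ×-dec deg (other G v x) ℕ.≟ 3) (nbrs G x)

  -- The vertices x, a₁, a₂, a₃ and y, the 3-vertex behind a₁, are uncolored. Among them the square
  -- has the edges of `KiteColoring`: x and its neighbors are pairwise adjacent, and y is adjacent
  -- to a₁ and x only.
  module Kite {x a₁ a₂ a₃ : Fin n} (xa₁ : Adj G x a₁) (xa₂ : Adj G x a₂) (xa₃ : Adj G x a₃)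
    (x-cover : ∀ {z} → Adj G x z → z ∈ a₁ ∷ a₂ ∷ a₃ ∷ [])
    (a₁≢a₂ : a₁ ≢ a₂) (a₁≢a₃ : a₁ ≢ a₃) (a₂≢a₃ : a₂ ≢ a₃)
    (tight : Tight x) (all-two : ∀ {z} → Adj G (other G a₁ x) z → deg z ≡ 2) where

    dx : deg x ≡ 3
    dx = proj₁ tight

    da : ∀ {a} → Adj G x a → deg a ≡ 2
    da xa = proj₁ (All.lookup (proj₂ tight) (∈-nbrs⁺ G xa))

    far : Fin n → Fin n
    far a = other G a x

    d-far : ∀ {a} → Adj G x a → deg (far a) ≡ 3
    d-far xa = proj₂ (All.lookup (proj₂ tight) (∈-nbrs⁺ G xa))

    a-far : ∀ {a} → Adj G x a → Adj G a (far a)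
    a-far xa = other-adj G (da xa) (symAdj G xa)

    a-cover : ∀ {a z} → Adj G x a → Adj G a z → z ≡ x ⊎ z ≡ far a
    a-cover xa = other-cover G (da xa) (symAdj G xa)

    y : Fin n
    y = far a₁

    -- With x in T, the vertex a₁ would not be in T, and would get at most two square-neighbors
    -- through x and three through y.
    x∉T : x ∉ T
    x∉T x∈T = contradiction
      (ℕ.≤-trans (φ-two (da xa₁) (symAdj G xa₁) (λ a₁∈T → independent x∈T a₁∈T xa₁))
        (ℕ.+-mono-≤
          (s≤s⁻¹ (ℕ.≤-trans (φ-< (symAdj G xa₁) (λ a₁∈T → independent x∈T a₁∈T xa₁) x∈T (here refl)) (ℕ.≤-reflexive dx)))
          (ℕ.≤-trans (φ-≤ (a-far xa₁)) (ℕ.≤-reflexive (d-far xa₁)))))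
      λ { (s≤s (s≤s (s≤s (s≤s (s≤s ()))))) }

    far-in : ∀ {z ws} → y ∈ ws → far a₂ ∈ ws → far a₃ ∈ ws → z ∈ a₁ ∷ a₂ ∷ a₃ ∷ [] → far z ∈ ws
    far-in p q r (here refl)                 = p
    far-in p q r (there (here refl))         = q
    far-in p q r (there (there (here refl))) = r

    x-square : ∀ {u} → Adj H x u → u ∈ a₁ ∷ a₂ ∷ a₃ ∷ [] ⊎ ∃ λ z → z ∈ a₁ ∷ a₂ ∷ a₃ ∷ [] × u ≡ far z
    x-square xu@(x≢u , _) with square⁻ G xu
    ... | inj₁ e = inj₁ (x-cover e)
    ... | inj₂ (z , e , f) with a-cover e f
    ...   | inj₁ u≡x = contradiction (sym u≡x) x≢u
    ...   | inj₂ u≡f = inj₂ (z , x-cover e , u≡f)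

    -- If a₁, a₂, a₃ led to only two vertices, x would have at most five square-neighbors.
    no-five : ∀ {f} → ¬ (∀ {z} → z ∈ a₁ ∷ a₂ ∷ a₃ ∷ [] → far z ∈ y ∷ f ∷ [])
    no-five {f} far∈ = contradiction
      (ℕ.≤-trans (saturated x∉T) (outer-length (a₁ ∷ a₂ ∷ a₃ ∷ y ∷ f ∷ []) cov))
      λ { (s≤s (s≤s (s≤s (s≤s (s≤s ()))))) }
      where
        cov : Covers T x (a₁ ∷ a₂ ∷ a₃ ∷ y ∷ f ∷ [])
        cov _ xu with x-square xu
        ... | inj₁ u∈              = ∈-++⁺ˡ u∈
        ... | inj₂ (z , z∈ , refl) = ∈-++⁺ʳ (a₁ ∷ a₂ ∷ a₃ ∷ []) (far∈ z∈)

    far₂≢y : far a₂ ≢ y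
    far₂≢y eq = no-five (far-in 1st (here eq) 2nd)

    far₃≢y : far a₃ ≢ y
    far₃≢y eq = no-five (far-in 1st 2nd (here eq))

    -- Both neighbors of a, x and `far a`, are 3-vertices different from y, and y has only
    -- 2-vertices as neighbors; so y is neither adjacent to a nor joined to it by a path of length
    -- 2.
    y≁ : ∀ {a} → Adj G x a → far a ≢ y → ¬ Adj H y a
    y≁ {a} xa far≢y ya with square⁻ G ya
    ... | inj₁ e with a-cover xa (symAdj G e)
    ...   | inj₁ y≡x   = other-≢ G (da xa₁) (symAdj G xa₁) y≡x
    ...   | inj₂ y≡far = far≢y (sym y≡far)
    y≁ {a} xa far≢y ya | inj₂ (z , e , f) with a-cover xa (symAdj G f)
    ... | inj₁ refl = deg-≢ dx (all-two e) (λ ()) refl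
    ... | inj₂ refl = deg-≢ (d-far xa) (all-two e) (λ ()) refl

    S : List (Fin n)
    S = y ∷ a₁ ∷ x ∷ a₂ ∷ a₃ ∷ []

    S-unique : Unique S
    S-unique =
      (deg-≢ (d-far xa₁) (da xa₁) (λ ()) ∷ other-≢ G (da xa₁) (symAdj G xa₁) ∷
        deg-≢ (d-far xa₁) (da xa₂) (λ ()) ∷ deg-≢ (d-far xa₁) (da xa₃) (λ ()) ∷ []) ∷
      (deg-≢ (da xa₁) dx (λ ()) ∷ a₁≢a₂ ∷ a₁≢a₃ ∷ []) ∷
      (deg-≢ dx (da xa₂) (λ ()) ∷ deg-≢ dx (da xa₃) (λ ()) ∷ []) ∷
      (a₂≢a₃ ∷ []) ∷ [] ∷ []

    as⊆S : ∀ {z} → z ∈ a₁ ∷ a₂ ∷ a₃ ∷ [] → z ∈ S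
    as⊆S (here refl)                 = 2nd
    as⊆S (there (here refl))         = there 3rd
    as⊆S (there (there (here refl))) = there (there 3rd)

    remove-nbrs : ∀ {u z} → Adj G u z → deg u ≡ 3 → length (remove z (nbrs G u)) ≤ 2
    remove-nbrs uz du = s≤s⁻¹ (ℕ.≤-trans (length-remove (∈-nbrs⁺ G uz)) (ℕ.≤-reflexive du))

    cover-y : Covers S y (remove a₁ (nbrs G y) ++ map (λ z → other G z y) (remove a₁ (nbrs G y)))
    cover-y {u} u∉S yu@(y≢u , _) with square⁻ G yu
    ... | inj₁ e = ∈-++⁺ˡ (∈-remove⁺ (∈-nbrs⁺ G e) λ { refl → u∉S 2nd })
    ... | inj₂ (z , e , f) with z ≟ a₁
    ...   | yes refl with a-cover xa₁ f
    ...     | inj₁ refl = contradiction 3rd u∉S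
    ...     | inj₂ refl = contradiction refl y≢u
    cover-y {u} u∉S yu@(y≢u , _) | inj₂ (z , e , f) | no z≢a₁
      with other-cover G (all-two e) (symAdj G e) f
    ... | inj₁ u≡y  = contradiction (sym u≡y) y≢u
    ... | inj₂ refl = ∈-++⁺ʳ (remove a₁ (nbrs G y))
          (∈-map⁺ (λ z → other G z y) (∈-remove⁺ (∈-nbrs⁺ G e) z≢a₁))

    cover-a : ∀ {a} → Adj G x a → Covers S a (far a ∷ remove a (nbrs G (far a)))
    cover-a xa u∉S au@(a≢u , _) with square⁻ G au
    ... | inj₁ e with a-cover xa e
    ...   | inj₁ refl = contradiction 3rd u∉S
    ...   | inj₂ u≡f  = here u≡f
    cover-a xa u∉S au@(a≢u , _) | inj₂ (z , e , f) with a-cover xa e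
    ... | inj₁ refl = contradiction (as⊆S (x-cover f)) u∉S
    ... | inj₂ refl = there (∈-remove⁺ (∈-nbrs⁺ G f) (≢-sym a≢u))

    cover-a₁ : Covers S a₁ (remove a₁ (nbrs G y))
    cover-a₁ u∉S au with cover-a xa₁ u∉S au
    ... | here refl = contradiction 1st u∉S
    ... | there u∈  = u∈

    cover-x : Covers S x (far a₂ ∷ far a₃ ∷ [])
    cover-x u∉S xu with x-square xu
    ... | inj₁ u∈ = contradiction (as⊆S u∈) u∉S
    ... | inj₂ (_ , here refl , refl)                 = contradiction 1st u∉S
    ... | inj₂ (_ , there (here refl) , refl)         = 1st
    ... | inj₂ (_ , there (there (here refl)) , refl) = 2nd

    pairwise : (d : Fin n → ℕ) → ∀ {vs} → AllPairs (λ u v → Adj H u v → d u ≢ d v) vs →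
               ∀ {u v} → u ∈ vs → v ∈ vs → Adj H u v → d u ≢ d v
    pairwise d (_ ∷ _)  (here refl) (here refl) a = contradiction a (irrefl H refl)
    pairwise d (p ∷ _)  (here refl) (there v∈)  a = All.lookup p v∈ a
    pairwise d (p ∷ _)  (there u∈)  (here refl) a = ≢-sym (All.lookup p u∈ (symAdj H a))
    pairwise d (_ ∷ ps) (there u∈)  (there v∈)  a = pairwise d ps u∈ v∈ a

    module _ (κ : Coloring S) where

      finish : ¬ KiteColoring (palette κ y) (palette κ a₁) (palette κ x) (palette κ a₂) (palette κ a₃)
      finish (cy , c₁ , cx , c₂ , c₃ , (y∈ , 1∈ , x∈ , 2∈ , 3∈) , (y≢1 , y≢x) , (1≢x , 1≢2 , 1≢3) , (x≢2 , x≢3) , 2≢3) =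
        uncolorable (extend S κ d
          (λ { (here refl)                                 → subst (_∈ palette κ y) (sym ey) y∈
             ; (there (here refl))                         → subst (_∈ palette κ a₁) (sym e₁) 1∈
             ; (there (there (here refl)))                 → subst (_∈ palette κ x) (sym ex) x∈
             ; (there (there (there (here refl))))         → subst (_∈ palette κ a₂) (sym e₂) 2∈
             ; (there (there (there (there (here refl))))) → subst (_∈ palette κ a₃) (sym e₃) 3∈ })
          (pairwise d
            ((differ ey e₁ y≢1 ∷ differ ey ex y≢x ∷
              (λ a → contradiction a (y≁ xa₂ far₂≢y)) ∷ (λ a → contradiction a (y≁ xa₃ far₃≢y)) ∷ []) ∷
             (differ e₁ ex 1≢x ∷ differ e₁ e₂ 1≢2 ∷ differ e₁ e₃ 1≢3 ∷ []) ∷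
             (differ ex e₂ x≢2 ∷ differ ex e₃ x≢3 ∷ []) ∷
             (differ e₂ e₃ 2≢3 ∷ []) ∷ [] ∷ [])))
        where
          ρ = (y , cy) ∷ (a₁ , c₁) ∷ (x , cx) ∷ (a₂ , c₂) ∷ (a₃ , c₃) ∷ []
          d : Fin n → ℕ
          d = assign ρ
          ey : d y ≡ cy
          ey = assign-∈ {ρ = ρ} S-unique (here refl)
          e₁ : d a₁ ≡ c₁
          e₁ = assign-∈ {ρ = ρ} S-unique (there (here refl))
          ex : d x ≡ cx
          ex = assign-∈ {ρ = ρ} S-unique (there (there (here refl)))
          e₂ : d a₂ ≡ c₂
          e₂ = assign-∈ {ρ = ρ} S-unique (there (there (there (here refl))))
          e₃ : d a₃ ≡ c₃
          e₃ = assign-∈ {ρ = ρ} S-unique (there (there (there (there (here refl)))))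
          differ : ∀ {u v c c′} → d u ≡ c → d v ≡ c′ → c ≢ c′ → Adj H u v → d u ≢ d v
          differ eu ev c≢c′ _ eq = c≢c′ (trans (sym eu) (trans eq ev))

      uniq : ∀ v → Unique (palette κ v)
      uniq = palette-unique L-unique L-length κ
      r : length (remove a₁ (nbrs G y)) ≤ 2
      r = remove-nbrs (symAdj G (a-far xa₁)) (d-far xa₁)
      -- Colored square-neighbors: at most four of y (two 2-vertices and the vertices behind them),
      -- two each of a₁ and x, three each of a₂ and a₃.
      ly : 2 ≤ length (palette κ y)
      ly = palette-≥ κ y 2 _ (ℕ.+-monoˡ-≤ 2 (ℕ.≤-trans (ℕ.≤-reflexive (length-++ (remove a₁ (nbrs G y))))
             (ℕ.+-mono-≤ r (ℕ.≤-trans (ℕ.≤-reflexive (length-map _ (remove a₁ (nbrs G y)))) r)))) cover-y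
      l₁ : 4 ≤ length (palette κ a₁)
      l₁ = palette-≥ κ a₁ 4 _ (ℕ.+-monoˡ-≤ 4 r) cover-a₁
      lx : 3 ≤ length (palette κ x)
      lx = palette-≥ κ x 3 _ (s≤s (s≤s (s≤s (s≤s (s≤s z≤n))))) cover-x
      l₂ : 3 ≤ length (palette κ a₂)
      l₂ = palette-≥ κ a₂ 3 _ (s≤s (ℕ.+-monoˡ-≤ 3 (remove-nbrs (symAdj G (a-far xa₂)) (d-far xa₂)))) (cover-a xa₂)
      l₃ : 3 ≤ length (palette κ a₃)
      l₃ = palette-≥ κ a₃ 3 _ (s≤s (ℕ.+-monoˡ-≤ 3 (remove-nbrs (symAdj G (a-far xa₃)) (d-far xa₃)))) (cover-a xa₃)

      not-extendable : ⊥
      not-extendable = finish (kite-colorable (uniq y) (uniq a₁) (uniq x) (uniq a₂) (uniq a₃) ly l₁ lx l₂ l₃)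

    absurd : ⊥
    absurd = inside S 2nd 3rd (symAdj G xa₁) not-extendable

  tight-clash : ∀ {x a} → Tight x → Adj G x a → ¬ (∀ {z} → Adj G (other G a x) z → deg z ≡ 2)
  tight-clash {x} {a} tight xa all-two
    with remove a (nbrs G x) in eq | Unique.filter⁺ (λ z → ¬? (z ≟ a)) (nbrs-unique G x)
       | length-remove {xs = nbrs G x} (∈-nbrs⁺ G xa) | length-remove-unique {v = a} (nbrs-unique G x)
  ... | p ∷ q ∷ [] | (p≢q ∷ []) ∷ _ | _ | _ =
        Kite.absurd xa (∈-nbrs⁻ G (proj₁ p∈)) (∈-nbrs⁻ G (proj₁ q∈)) cov
          (≢-sym (proj₂ p∈)) (≢-sym (proj₂ q∈)) p≢q tight all-two
    where
      p∈ = ∈-remove⁻ {v = a} {xs = nbrs G x} (subst (p ∈_) (sym eq) 1st)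
      q∈ = ∈-remove⁻ {v = a} {xs = nbrs G x} (subst (q ∈_) (sym eq) 2nd)
      cov : ∀ {z} → Adj G x z → z ∈ a ∷ p ∷ q ∷ []
      cov {z} xz with z ≟ a
      ... | yes refl = 1st
      ... | no z≢a   = there (subst (z ∈_) eq (∈-remove⁺ (∈-nbrs⁺ G xz) z≢a))
  ... | []          | _ | _ | le = contradiction (subst (_≤ 1) (proj₁ tight) le) λ { (s≤s ()) }
  ... | _ ∷ []      | _ | _ | le = contradiction (subst (_≤ 2) (proj₁ tight) le) λ { (s≤s (s≤s ())) }
  ... | _ ∷ _ ∷ _ ∷ _ | _ | lt | _ = contradiction (subst (_ ≺_) (proj₁ tight) lt) λ { (s≤s (s≤s (s≤s ()))) }

-- Cycles of threads, and the number of ends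

module Forest {n : ℕ} {G : Graph n} (critical : Critical G)
  (system : Structure.EndSystem critical) where

  open Structure critical
  open Reducible critical using (palette-≥)
  open EndSystem system

  E : Set
  E = Fin n × Fin n

  _≟ᴱ_ : (e f : E) → Dec (e ≡ f)
  _≟ᴱ_ = ≡-dec _≟_ _≟_

  hub tip : E → Fin n
  hub = proj₁
  tip = proj₂

  -- A closed walk that alternates between the two ends of a thread and two ends
  -- at the same hub, and whose hubs are distinct.
  record Cycle : Set where
    field
      m     : ℕ
      e     : ℕ → E
      end   : ∀ k → End (e k)
      next  : ∀ k → hub (e (suc k)) ≡ hub (π (e k))
      turn  : ∀ k → e (suc k) ≢ π (e k)
      inj   : ∀ {i j} → i ≤ m → j ≤ m → hub (e i) ≡ hub (e j) → i ≡ j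
      close : hub (e (suc m)) ≡ hub (e 0)

  module CycleColoring (cycle : Cycle) where

    open Cycle cycle

    hub-next : ∀ {i j} → i ≤ m → j ≤ m → hub (e i) ≡ hub (π (e j)) →
               (suc j ≤ m × i ≡ suc j) ⊎ (j ≡ m × i ≡ 0)
    hub-next {i} {j} i≤m j≤m eq with ℕ.m≤n⇒m<n∨m≡n j≤m
    ... | inj₁ j<m  = inj₁ (j<m , inj i≤m j<m (trans eq (sym (next j))))
    ... | inj₂ refl = inj₂ (refl , inj i≤m z≤n (trans eq (trans (sym (next m)) close)))

    e≢πe : ∀ k → e k ≢ π (e k)
    e≢πe k eq = π-≢ (end k) (cong hub (sym eq))

    -- Hubs determine positions, so `turn` settles all cases but i = 0, j = m, where the walk
    -- closes. There `π` turns the equation into e m = π (e 0), which leaves m = 1, again against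
    -- `turn`, and m = 0, against `π-≢`.
    distinct : ∀ {i j} → i ≤ m → j ≤ m → e i ≢ π (e j)
    distinct {i} {j} i≤m j≤m eq with hub-next i≤m j≤m (cong hub eq)
    ... | inj₁ (_ , refl)    = turn j eq
    ... | inj₂ (refl , refl) with hub-next j≤m z≤n (cong hub (trans (sym (ππ (end j))) (cong π (sym eq))))
    ...   | inj₁ (_ , refl)  = turn 0 (trans (sym (ππ (end 1))) (cong π (sym eq)))
    ...   | inj₂ (_ , refl)  = e≢πe 0 eq

    -- The 2 (m + 1) ends in cyclic order: the thread of `e k` occupies positions 2k and 2k + 1.
    ε : ℕ → E
    ε i = if even i then e ⌊ i /2⌋ else π (e ⌊ i /2⌋)

    ε-even : ∀ k → ε (k · 2) ≡ e k
    ε-even k rewrite even-double k | half-double k = refl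

    ε-odd : ∀ k → ε (suc (k · 2)) ≡ π (e k)
    ε-odd k rewrite odd-double k | half-odd k = refl

    M : ℕ
    M = suc (m · 2)

    even≤ : ∀ {k} → k ≤ m → k · 2 ≤ M
    even≤ k≤m = ℕ.m≤n⇒m≤1+n (ℕ.*-monoˡ-≤ 2 k≤m)

    odd≤ : ∀ {k} → k ≤ m → suc (k · 2) ≤ M
    odd≤ k≤m = s≤s (ℕ.*-monoˡ-≤ 2 k≤m)

    S : List (Fin n)
    S = map (tip ∘ ε) (upTo (suc M))

    ∈S : ∀ {i} → i ≤ M → tip (ε i) ∈ S
    ∈S i≤M = ∈-map⁺ (tip ∘ ε) (∈-upTo⁺ (s≤s i≤M))

    S⁻ : ∀ {v} → v ∈ S → ∃ λ i → i ≤ M × tip (ε i) ≡ v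
    S⁻ v∈ with ∈-map⁻ (tip ∘ ε) v∈
    ... | i , i∈ , refl = i , s≤s⁻¹ (∈-upTo⁻ i∈) , refl

    e∈S : ∀ {k} → k ≤ m → tip (e k) ∈ S
    e∈S {k} k≤m = subst (λ x → tip x ∈ S) (ε-even k) (∈S (even≤ k≤m))

    πe∈S : ∀ {k} → k ≤ m → tip (π (e k)) ∈ S
    πe∈S {k} k≤m = subst (λ x → tip x ∈ S) (ε-odd k) (∈S (odd≤ k≤m))

    -- Both square-neighbors of the end x on the cycle are left uncolored.
    record OnCycle (x : E) : Set where
      field
        x-end   : End x
        partner : tip (π x) ∈ S
        mate    : E
        mate-end : End mate
        mate-hub : hub mate ≡ hub x
        mate-≢  : mate ≢ x
        mate-∈  : tip mate ∈ S

    on-even : ∀ {k} → k ≤ m → OnCycle (e k)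
    on-even {zero}  k≤m = record
      { x-end = end 0 ; partner = πe∈S k≤m ; mate = π (e m) ; mate-end = π-End (end m)
      ; mate-hub = trans (sym (next m)) close ; mate-≢ = ≢-sym (distinct z≤n ℕ.≤-refl) ; mate-∈ = πe∈S ℕ.≤-refl }
    on-even {suc j} k≤m = record
      { x-end = end (suc j) ; partner = πe∈S k≤m ; mate = π (e j) ; mate-end = π-End (end j)
      ; mate-hub = sym (next j) ; mate-≢ = ≢-sym (turn j) ; mate-∈ = πe∈S (ℕ.<⇒≤ k≤m) }

    on-odd : ∀ {k} → k ≤ m → OnCycle (π (e k))
    on-odd {k} k≤m with ℕ.m≤n⇒m<n∨m≡n k≤m
    ... | inj₁ k<m  = record
      { x-end = π-End (end k) ; partner = subst (λ x → tip x ∈ S) (sym (ππ (end k))) (e∈S k≤m)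
      ; mate = e (suc k) ; mate-end = end (suc k) ; mate-hub = next k ; mate-≢ = turn k ; mate-∈ = e∈S k<m }
    ... | inj₂ refl = record
      { x-end = π-End (end k) ; partner = subst (λ x → tip x ∈ S) (sym (ππ (end k))) (e∈S k≤m)
      ; mate = e 0 ; mate-end = end 0 ; mate-hub = trans (sym close) (next m) ; mate-≢ = distinct z≤n k≤m
      ; mate-∈ = e∈S z≤n }

    on-cycle : ∀ {i} → i ≤ M → OnCycle (ε i)
    on-cycle {i} i≤M with parity i
    ... | inj₁ (k , refl) = subst OnCycle (sym (ε-even k)) (on-even (double-≤ i≤M))
    ... | inj₂ (k , refl) = subst OnCycle (sym (ε-odd k)) (on-odd (double-≤ (ℕ.m≤n⇒m≤1+n (s≤s⁻¹ i≤M))))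

    -- Partner and mate have their tips in S, so by `covered` at most four square-neighbors are
    -- colored.
    two-colors : ∀ (κ : Coloring (S ++ T)) {x} → OnCycle x → TwoColors (palette κ (tip x))
    two-colors κ {x} on with covered x-end mate-end mate-hub mate-≢
      where open OnCycle on
    ... | ws , ws≤4 , cov = pick-two (palette-unique L-unique L-length κ (tip x))
      (palette-≥ κ (tip x) 2 ws (ℕ.+-monoˡ-≤ 2 ws≤4) λ u∉ a →
        cov (u∉ ∘ ∈-++⁺ʳ S) (λ { refl → u∉ (∈-++⁺ˡ (OnCycle.partner on)) })
          (λ { refl → u∉ (∈-++⁺ˡ (OnCycle.mate-∈ on)) }) a)

    module _ (κ : Coloring (S ++ T)) where

      module _ (z : ℕ → ℕ) (z∈ : ∀ {i} → i ≤ M → z i ∈ palette κ (tip (ε i)))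
        (z≢ : ∀ {i} → i ≺ M → z i ≢ z (suc i)) (z-close : z 0 ≢ z M) where

        -- By `near`, square-adjacent tips belong to partners or to ends at one hub. On the cycle
        -- these occupy consecutive positions, the last and the first included; so positions of
        -- equal parity never clash.
        even-odd : ∀ {i j} → i ≤ m → j ≤ m → Adj H (tip (e i)) (tip (π (e j))) → z (i · 2) ≢ z (suc (j · 2))
        even-odd {i} {j} i≤m j≤m a with near (end i) (π-End (end j)) a
        ... | inj₂ same with hub-next i≤m j≤m same
        ...   | inj₁ (_ , refl)    = ≢-sym (z≢ (even≤ i≤m))
        ...   | inj₂ (refl , refl) = z-close
        even-odd {i} {j} i≤m j≤m a | inj₁ eq
          with inj j≤m i≤m (cong hub (trans (sym (ππ (end j))) (trans (cong π eq) (ππ (end i)))))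
        ... | refl = z≢ (odd≤ i≤m)

        even-even : ∀ {i j} → i ≤ m → j ≤ m → ¬ Adj H (tip (e i)) (tip (e j))
        even-even i≤m j≤m a with near (end _) (end _) a
        ... | inj₁ eq = distinct j≤m i≤m eq
        ... | inj₂ same with inj i≤m j≤m same
        ...   | refl = irrefl H refl a

        odd-odd : ∀ {i j} → i ≤ m → j ≤ m → ¬ Adj H (tip (π (e i))) (tip (π (e j)))
        odd-odd {i} {j} i≤m j≤m a with near (π-End (end i)) (π-End (end j)) a
        ... | inj₁ eq = distinct i≤m j≤m (trans (sym (ππ (end i))) (sym eq))
        ... | inj₂ same with ℕ.m≤n⇒m<n∨m≡n i≤m
        ...   | inj₁ i<m with hub-next i<m j≤m (trans (next i) same)
        ...     | inj₁ (_ , refl) = irrefl H refl a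
        ...     | inj₂ (_ , ())
        odd-odd {i} {j} i≤m j≤m a | inj₂ same | inj₂ refl
          with hub-next z≤n j≤m (trans (sym close) (trans (next m) same))
        ... | inj₁ (_ , ())
        ... | inj₂ (refl , _) = irrefl H refl a

        proper : ∀ {i j} → i ≤ M → j ≤ M → Adj H (tip (ε i)) (tip (ε j)) → z i ≢ z j
        proper {i} {j} i≤M j≤M a with parity i | parity j
        ... | inj₁ (k , refl) | inj₁ (l , refl) rewrite ε-even k | ε-even l =
          contradiction a (even-even (double-≤ i≤M) (double-≤ j≤M))
        ... | inj₁ (k , refl) | inj₂ (l , refl) rewrite ε-even k | ε-odd l =
          even-odd (double-≤ i≤M) (double-≤ (ℕ.<⇒≤ j≤M)) a
        ... | inj₂ (k , refl) | inj₁ (l , refl) rewrite ε-odd k | ε-even l =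
          ≢-sym (even-odd (double-≤ j≤M) (double-≤ (ℕ.<⇒≤ i≤M)) (symAdj H a))
        ... | inj₂ (k , refl) | inj₂ (l , refl) rewrite ε-odd k | ε-odd l =
          contradiction a (odd-odd (double-≤ (ℕ.<⇒≤ i≤M)) (double-≤ (ℕ.<⇒≤ j≤M)))

        -- Any position with tip v serves, since `proper` compares positions; 0 is the default off
        -- S.
        position : Fin n → ℕ
        position v with ℕ.anyUpTo? (λ i → tip (ε i) ≟ v) (suc M)
        ... | yes (i , _) = i
        ... | no _        = 0

        position-spec : ∀ {v} → v ∈ S → position v ≤ M × tip (ε (position v)) ≡ v
        position-spec {v} v∈ with ℕ.anyUpTo? (λ i → tip (ε i) ≟ v) (suc M)
        ... | yes (i , i< , eq) = s≤s⁻¹ i< , eq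
        ... | no none = let i , i≤ , eq = S⁻ v∈ in contradiction (i , s≤s i≤ , eq) none

        finish : ⊥
        finish = T-uncolorable (extend S κ (z ∘ position) d∈ d≢)
          where
            d∈ : ∀ {v} → v ∈ S → z (position v) ∈ palette κ v
            d∈ {v} v∈ with position-spec v∈
            ... | i≤ , eq = subst (λ x → z (position v) ∈ palette κ x) eq (z∈ i≤)
            d≢ : ∀ {u v} → u ∈ S → v ∈ S → Adj H u v → z (position u) ≢ z (position v)
            d≢ {u} {v} u∈ v∈ a with position-spec u∈ | position-spec v∈
            ... | i≤ , eq | j≤ , eq′ = proper i≤ j≤
              (subst (λ x → Adj H x (tip (ε (position v)))) (sym eq) (subst (Adj H u) (sym eq′) a))

      not-extendable : ⊥
      not-extendable with even-cycle-colorable m (λ {i} i≤ → two-colors κ (on-cycle {i} i≤))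
      ... | z , z∈ , z≢ , z-close = finish z z∈ z≢ z-close

    absurd : ⊥
    -- The edge to delete joins a tip to the middle of its thread, which is in T, or to the tip of
    -- the partner.
    absurd with inner (end 0)
    ... | z , a , inj₁ z∈T  = inside (S ++ T) (∈-++⁺ˡ (e∈S z≤n)) (∈-++⁺ʳ S z∈T) a not-extendable
    ... | z , a , inj₂ refl = inside (S ++ T) (∈-++⁺ˡ (e∈S z≤n)) (∈-++⁺ˡ (πe∈S z≤n)) a not-extendable

  at : Fin n → List E → List E
  at w = filter (λ e → hub e ≟ w)

  module _ {P : List E} (P-End : ∀ {e} → e ∈ P → End e) (P-π : ∀ {e} → e ∈ P → π e ∈ P)
    (P-mate : ∀ {e} → e ∈ P → ∃ λ f → f ∈ P × hub f ≡ hub e × f ≢ e) where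

    State : Set
    State = ∃ λ e → e ∈ P

    advance : State → State
    advance (e , e∈) = let f , f∈ , _ = P-mate (P-π e∈) in f , f∈

    run : ℕ → State → State
    run zero    s = s
    run (suc k) s = advance (run k s)

    run-+ : ∀ k i s → run k (run i s) ≡ run (k ⊹ i) s
    run-+ zero    i s = refl
    run-+ (suc k) i s = cong advance (run-+ k i s)

    h : State → ℕ → Fin n
    h s k = hub (proj₁ (run k s))

    Injective< : State → ℕ → Set
    Injective< s j = ∀ {a b} → a ≺ b → b ≺ j → h s a ≢ h s b

    found : ∀ {s i j} → Injective< s j → i ≺ j → h s i ≡ h s j → Cycle
    -- Here j = i + m + 1: the walk from i to j crosses m + 1 threads.
    found {s} {i} {j} inj i<j eq with ℕ.m≤n⇒∃[o]m+o≡n i<j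
    ... | m , refl = record
      { m = m
      ; e = λ k → proj₁ (run k s′)
      ; end = λ k → P-End (proj₂ (run k s′))
      ; next = λ k → proj₁ (proj₂ (proj₂ (P-mate (P-π (proj₂ (run k s′))))))
      ; turn = λ k → proj₂ (proj₂ (proj₂ (P-mate (P-π (proj₂ (run k s′))))))
      ; inj = inj′
      ; close = trans (shift (suc m)) (trans (cong (λ k → hub (proj₁ (run k s))) (cong suc (ℕ.+-comm m i))) (sym eq))
      }
      where
        s′ = run i s
        shift : ∀ k → h s′ k ≡ h s (k ⊹ i)
        shift k = cong (hub ∘ proj₁) (run-+ k i s)
        lt : ∀ {a b} → a ≺ b → b ≤ m → h s′ a ≢ h s′ b
        lt {a} {b} a<b b≤m e = inj (ℕ.+-monoˡ-< i a<b)
          (s≤s (ℕ.≤-trans (ℕ.+-monoˡ-≤ i b≤m) (ℕ.≤-reflexive (ℕ.+-comm m i))))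
          (trans (sym (shift a)) (trans e (shift b)))
        inj′ : ∀ {a b} → a ≤ m → b ≤ m → h s′ a ≡ h s′ b → a ≡ b
        inj′ {a} {b} a≤m b≤m e with ℕ.<-cmp a b
        ... | tri< a<b _ _ = contradiction e (lt a<b b≤m)
        ... | tri≈ _ a≡b _ = a≡b
        ... | tri> _ _ b<a = contradiction (sym e) (lt b<a a≤m)

    -- The first j hubs are distinct, so j cannot exceed n, and a repetition appears before the fuel
    -- is used up.
    search : ∀ s fuel j → Injective< s j → n ≺ fuel ⊹ j → Cycle
    search s zero j inj n<j with Finₚ.pigeonhole n<j (λ i → h s (Fin.toℕ i))
    ... | a , b , a<b , eq = contradiction eq (inj a<b (Finₚ.toℕ<n b))
    search s (suc fuel) j inj n< with ℕ.anyUpTo? (λ i → h s i ≟ h s j) j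
    ... | yes (i , i<j , eq) = found inj i<j eq
    ... | no none = search s fuel (suc j) inj′ (subst (n ≺_) (sym (ℕ.+-suc fuel j)) n<)
      where
        inj′ : Injective< s (suc j)
        inj′ a<b (s≤s b≤j) with ℕ.m≤n⇒m<n∨m≡n b≤j
        ... | inj₁ b<j  = inj a<b b<j
        ... | inj₂ refl = λ eq → none (_ , a<b , eq)

    no-mates : ∀ {e} → e ∉ P
    no-mates e∈ = CycleColoring.absurd (search (_ , e∈) (suc n) 0 (λ _ ()) (s≤s (ℕ.m≤m+n n 0)))

  -- Remove a hub with at most one end together with its thread. If there is no
  -- such hub, then following the threads leads to a cycle.
  ends-≤ : ∀ k W {P} → length W ≤ k → Unique P →
           (∀ {e} → e ∈ P → End e) → (∀ {e} → e ∈ P → π e ∈ P) → (∀ {e} → e ∈ P → hub e ∈ W) →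
           length P ≤ 2 · length W
  ends-≤ k W {P} W≤k u P-End P-π P-hub with Any.any? (λ w → length (at w P) ℕ.≤? 1) W
  ends-≤ k W {[]} W≤k u P-End P-π P-hub | no _ = z≤n
  ends-≤ k W {P@(_ ∷ _)} W≤k u P-End P-π P-hub | no many = contradiction (here refl) (no-mates P-End P-π mates)
    where
      second : ∀ {e : E} xs → Unique xs → 2 ≤ length xs → ∃ λ f → f ∈ xs × f ≢ e
      second (_ ∷ []) _ (s≤s ())
      second {e} (p ∷ q ∷ _) ((p≢q ∷ _) ∷ _) _ with p ≟ᴱ e
      ... | no p≢e   = p , 1st , p≢e
      ... | yes refl = q , 2nd , ≢-sym p≢q
      mates : ∀ {e} → e ∈ P → ∃ λ f → f ∈ P × hub f ≡ hub e × f ≢ e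
      mates {e} e∈ with second {e} (at (hub e) P) (Unique.filter⁺ (λ f → hub f ≟ hub e) u)
                          (ℕ.≰⇒> λ few → many (Any.map (λ { refl → few }) (P-hub e∈)))
      ... | f , f∈ , f≢e with ∈-filter⁻ (λ f → hub f ≟ hub e) {xs = P} f∈
      ...   | f∈P , same = f , f∈P , same , f≢e
  ends-≤ zero    (_ ∷ _) ()  u P-End P-π P-hub | yes _
  ends-≤ (suc k) W {P} W≤k u P-End P-π P-hub | yes few with find few
  ... | w , w∈W , few-at = begin
      length P                                              ≤⟨ Unique-⊆-length u cover ⟩
      length (at w P ++ map π (at w P) ++ P′)               ≡⟨ length-++ (at w P) ⟩
      length (at w P) ⊹ length (map π (at w P) ++ P′)       ≡⟨ cong (length (at w P) ⊹_) (length-++ (map π (at w P))) ⟩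
      length (at w P) ⊹ (length (map π (at w P)) ⊹ length P′)
        ≤⟨ ℕ.+-mono-≤ few-at (ℕ.+-mono-≤ (ℕ.≤-trans (ℕ.≤-reflexive (length-map π (at w P))) few-at) ih) ⟩
      2 ⊹ 2 · length (remove w W)                           ≡⟨ ℕ.*-suc 2 (length (remove w W)) ⟨
      2 · suc (length (remove w W))                         ≤⟨ ℕ.*-monoʳ-≤ 2 (length-remove w∈W) ⟩
      2 · length W                                          ∎
    where
      open ℕ.≤-Reasoning
      away? : Decidable₁ (λ e → hub e ≢ w × hub (π e) ≢ w)
      away? e = ¬? (hub e ≟ w) ×-dec ¬? (hub (π e) ≟ w)
      P′ = filter away? P
      P′⁻ : ∀ {e} → e ∈ P′ → e ∈ P × hub e ≢ w × hub (π e) ≢ w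
      P′⁻ = ∈-filter⁻ away?
      cover : ∀ {e} → e ∈ P → e ∈ at w P ++ map π (at w P) ++ P′
      cover {e} e∈ with hub e ≟ w | hub (π e) ≟ w
      ... | yes eq | _      = ∈-++⁺ˡ (∈-filter⁺ (λ e → hub e ≟ w) e∈ eq)
      ... | no _   | yes eq = ∈-++⁺ʳ (at w P) (∈-++⁺ˡ (subst (_∈ map π (at w P)) (ππ (P-End e∈))
                                (∈-map⁺ π (∈-filter⁺ (λ e → hub e ≟ w) (P-π e∈) eq))))
      ... | no ≢₁  | no ≢₂  = ∈-++⁺ʳ (at w P) (∈-++⁺ʳ (map π (at w P)) (∈-filter⁺ away? e∈ (≢₁ , ≢₂)))
      ih : length P′ ≤ 2 · length (remove w W)
      ih = ends-≤ k (remove w W) (s≤s⁻¹ (ℕ.≤-trans (length-remove w∈W) W≤k)) (Unique.filter⁺ away? u)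
        (λ p → P-End (proj₁ (P′⁻ p)))
        (λ {e} p → let q , r , s = P′⁻ p in
          ∈-filter⁺ away? (P-π q) (s , λ eq → r (trans (cong hub (sym (ππ (P-End q)))) eq)))
        (λ p → let q , r , s = P′⁻ p in ∈-remove⁺ (P-hub q) r)

-- Finite sums

𝟙 : {P : Set} → Dec P → ℕ
𝟙 p? = if does p? then 1 else 0

𝟙-yes : {P : Set} (p? : Dec P) → P → 𝟙 p? ≡ 1
𝟙-yes (yes _) _ = refl
𝟙-yes (no ¬p) p = contradiction p ¬p

∑-mono : ∀ {f g : X → ℕ} xs → (∀ x → f x ≤ g x) → ∑ xs f ≤ ∑ xs g
∑-mono []       f≤g = z≤n
∑-mono (x ∷ xs) f≤g = ℕ.+-mono-≤ (f≤g x) (∑-mono xs f≤g)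

∑-cong : ∀ {f g : X → ℕ} xs → (∀ x → f x ≡ g x) → ∑ xs f ≡ ∑ xs g
∑-cong []       f≡g = refl
∑-cong (x ∷ xs) f≡g = cong₂ _⊹_ (f≡g x) (∑-cong xs f≡g)

+-interchange : ∀ a b c d → (a ⊹ b) ⊹ (c ⊹ d) ≡ (a ⊹ c) ⊹ (b ⊹ d)
+-interchange = solve 4 (λ a b c d → (a :+ b) :+ (c :+ d) := (a :+ c) :+ (b :+ d)) refl
  where open +-*-Solver

∑-+ : ∀ (f g : X → ℕ) xs → ∑ xs (λ x → f x ⊹ g x) ≡ ∑ xs f ⊹ ∑ xs g
∑-+ f g []       = refl
∑-+ f g (x ∷ xs) = trans (cong (f x ⊹ g x ⊹_) (∑-+ f g xs)) (+-interchange (f x) (g x) _ _)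

∑-* : ∀ c (f : X → ℕ) xs → ∑ xs (λ x → c · f x) ≡ c · ∑ xs f
∑-* c f []       = sym (ℕ.*-zeroʳ c)
∑-* c f (x ∷ xs) = trans (cong (c · f x ⊹_) (∑-* c f xs)) (sym (ℕ.*-distribˡ-+ c (f x) (∑ xs f)))

∑-const : ∀ c (xs : List X) → ∑ xs (λ _ → c) ≡ length xs · c
∑-const c []       = refl
∑-const c (x ∷ xs) = cong (c ⊹_) (∑-const c xs)

∑-++ : ∀ (f : X → ℕ) xs ys → ∑ (xs ++ ys) f ≡ ∑ xs f ⊹ ∑ ys f
∑-++ f []       ys = refl
∑-++ f (x ∷ xs) ys = trans (cong (f x ⊹_) (∑-++ f xs ys)) (sym (ℕ.+-assoc (f x) _ _))

∑-map : ∀ (f : Y → ℕ) (h : X → Y) xs → ∑ (map h xs) f ≡ ∑ xs (f ∘ h)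
∑-map f h []       = refl
∑-map f h (x ∷ xs) = cong (f (h x) ⊹_) (∑-map f h xs)

∑-swap : ∀ (f : X → Y → ℕ) xs ys → ∑ xs (λ x → ∑ ys (f x)) ≡ ∑ ys (λ y → ∑ xs (λ x → f x y))
∑-swap f []       ys = sym (trans (∑-const 0 ys) (ℕ.*-zeroʳ (length ys)))
∑-swap f (x ∷ xs) ys = trans (cong (∑ ys (f x) ⊹_) (∑-swap f xs ys)) (sym (∑-+ (f x) _ ys))

∑-product : ∀ (f : X × Y → ℕ) xs ys → ∑ (cartesianProduct xs ys) f ≡ ∑ xs (λ x → ∑ ys (λ y → f (x , y)))
∑-product f []       ys = refl
∑-product f (x ∷ xs) ys = trans (∑-++ f (map (x ,_) ys) _) (cong₂ _⊹_ (∑-map f (x ,_) ys) (∑-product f xs ys))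

∑-filter : ∀ {P : X → Set} (P? : Decidable₁ P) (f : X → ℕ) xs →
           ∑ (filter P? xs) f ≡ ∑ xs (λ x → if does (P? x) then f x else 0)
∑-filter P? f [] = refl
∑-filter P? f (x ∷ xs) with does (P? x)
... | true  = cong (f x ⊹_) (∑-filter P? f xs)
... | false = ∑-filter P? f xs

∑-filter-≤ : ∀ {P : X → Set} (P? : Decidable₁ P) (f : X → ℕ) xs → ∑ (filter P? xs) f ≤ ∑ xs f
∑-filter-≤ P? f [] = z≤n
∑-filter-≤ P? f (x ∷ xs) with does (P? x)
... | true  = ℕ.+-monoʳ-≤ (f x) (∑-filter-≤ P? f xs)
... | false = ℕ.≤-trans (∑-filter-≤ P? f xs) (ℕ.m≤n+m _ (f x))

length-filter-∑ : ∀ {P : X → Set} (P? : Decidable₁ P) xs → length (filter P? xs) ≡ ∑ xs (𝟙 ∘ P?)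
length-filter-∑ P? [] = refl
length-filter-∑ P? (x ∷ xs) with does (P? x)
... | true  = cong suc (length-filter-∑ P? xs)
... | false = length-filter-∑ P? xs

∑-affine : ∀ c k (f : X → ℕ) xs → ∑ xs (λ x → c ⊹ k · f x) ≡ length xs · c ⊹ k · ∑ xs f
∑-affine c k f xs = trans (∑-+ (λ _ → c) (λ x → k · f x) xs) (cong₂ _⊹_ (∑-const c xs) (∑-* k f xs))

∑-All : ∀ {f g : X → ℕ} {xs} → All (λ x → f x ≤ g x) xs → ∑ xs f ≤ ∑ xs g
∑-All []       = z≤n
∑-All (p ∷ ps) = ℕ.+-mono-≤ p (∑-All ps)

∑-bound : ∀ {f : X → ℕ} {b xs} → All (λ x → f x ≤ b) xs → ∑ xs f ≤ length xs · b
∑-bound {b = b} {xs} all = ℕ.≤-trans (∑-All all) (ℕ.≤-reflexive (∑-const b xs))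

-- One term obeys the bound a in place of b; b is added on the left to avoid a subtraction.
∑-bound-one : ∀ {f : X → ℕ} {a b xs} → All (λ x → f x ≤ b) xs → Any (λ x → f x ≤ a) xs →
              b ⊹ ∑ xs f ≤ a ⊹ length xs · b
∑-bound-one {f = f} {a} {b} {x ∷ xs} (_ ∷ all) (here p) = begin
    b ⊹ (f x ⊹ ∑ xs f)        ≡⟨ solve 3 (λ b y s → b :+ (y :+ s) := y :+ (b :+ s)) refl b (f x) (∑ xs f) ⟩
    f x ⊹ (b ⊹ ∑ xs f)        ≤⟨ ℕ.+-mono-≤ p (ℕ.+-monoʳ-≤ b (∑-bound all)) ⟩
    a ⊹ (b ⊹ length xs · b)   ∎
  where
    open ℕ.≤-Reasoning
    open +-*-Solver
∑-bound-one {f = f} {a} {b} {x ∷ xs} (p ∷ all) (there any) = begin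
    b ⊹ (f x ⊹ ∑ xs f)        ≡⟨ solve 3 (λ b y s → b :+ (y :+ s) := y :+ (b :+ s)) refl b (f x) (∑ xs f) ⟩
    f x ⊹ (b ⊹ ∑ xs f)        ≤⟨ ℕ.+-mono-≤ p (∑-bound-one all any) ⟩
    b ⊹ (a ⊹ length xs · b)   ≡⟨ solve 3 (λ b y s → b :+ (y :+ s) := y :+ (b :+ s)) refl b a (length xs · b) ⟩
    a ⊹ (b ⊹ length xs · b)   ∎
  where
    open ℕ.≤-Reasoning
    open +-*-Solver

-- Discharging rules and their local balance

positive : ℕ → ℕ
positive zero    = 0
positive (suc _) = 1

-- A vertex of degree d has weight 29 d - 70. The final weight of a 5-vertex is at
-- least 10 minus 5 for each end of a thread of three 2-vertices, and that of a
-- 4-vertex at least 2 minus 1 for each end of a thread of two 2-vertices between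
-- 4-vertices; these are nonnegative on average by Forest.ends-≤.
module Discharging {n : ℕ} {G : Graph n} (critical : Critical G) where

  open Structure critical
  open Reducible critical using (Tight; Tight?; tight-clash)

  -- A tight vertex has weight 17 and cannot give 6 to each of its neighbors.
  share₃ : {P Q : Set} → Dec P → Dec Q → ℕ
  share₃ (yes _) _       = 5
  share₃ (no _)  (yes _) = 7
  share₃ (no _)  (no _)  = 6

  share₃-sum : {P Q : Set} (p? : Dec P) (q? : Dec Q) → ¬ (P × Q) → 12 ≤ share₃ p? q? ⊹ share₃ q? p?
  share₃-sum (yes p) (yes q) ¬both = contradiction (p , q) ¬both
  share₃-sum (yes _) (no _)  _     = ℕ.≤-refl
  share₃-sum (no _)  (yes _) _     = ℕ.≤-refl
  share₃-sum (no _)  (no _)  _     = ℕ.≤-refl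

  share₃-≤7 : {P Q : Set} (p? : Dec P) (q? : Dec Q) → share₃ p? q? ≤ 7
  share₃-≤7 (yes _) _       = ℕ.m≤m+n 5 2
  share₃-≤7 (no _)  (yes _) = ℕ.≤-refl
  share₃-≤7 (no _)  (no _)  = ℕ.m≤m+n 6 1

  share₃-≤6 : {P Q : Set} (p? : Dec P) (q? : Dec Q) → ¬ Q → share₃ p? q? ≤ 6
  share₃-≤6 (yes _) _       _  = ℕ.m≤m+n 5 1
  share₃-≤6 (no _)  (yes q) ¬q = contradiction q ¬q
  share₃-≤6 (no _)  (no _)  _  = ℕ.≤-refl

  share₃-yes : {P Q : Set} (p? : Dec P) (q? : Dec Q) → P → share₃ p? q? ≤ 5
  share₃-yes (yes _) _ _ = ℕ.≤-refl
  share₃-yes (no ¬p) _ p = contradiction p ¬p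

  -- What the 2-vertex between u and s still lacks of 12, by the degree of s: a 2-neighbor passes 1
  -- on, a 4-neighbor gives at least 11, a 5-neighbor at least 13, and two 3-neighbors split the 12.
  share : ℕ → Fin n → Fin n → ℕ
  share 2 u s = 11
  share 3 u s = share₃ (Tight? u) (Tight? s)
  share 4 u s = 1
  share _ u s = 0

  -- A 2-vertex next to a 5-vertex hands on to a 2-vertex what exceeds its own 12: 18 - 12 toward
  -- the middle of three 2-vertices, else 13 - 12. The arguments are the degrees behind the giver
  -- and behind the receiver.
  pass : ℕ → ℕ → ℕ
  pass 5 2 = 6
  pass 5 _ = 1
  pass _ _ = 0

  -- The weights 75 and 46 leave 10 after five gifts of 13 and 2 after four gifts of 11. Neighbors
  -- of every degree receive these gifts; `WithT` below relies on those to 3-vertices.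
  give : ℕ → ℕ → Fin n → Fin n → ℕ
  give 5 _ u v = 13 ⊹ 5 · 𝟙 (End₅? (u , v))
  give 4 _ u v = 11 ⊹ 1 · 𝟙 (End₄? (u , v))
  give 3 2 u v = share (deg (other G v u)) u (other G v u)
  give 2 2 u v = pass (deg (other G u v)) (deg (other G v u))
  give _ _ u v = 0

  charge : Fin n → Fin n → ℕ
  charge u v = give (deg u) (deg v) u v

  charge-at : ∀ {u v k l} → deg u ≡ k → deg v ≡ l → charge u v ≡ give k l u v
  charge-at refl refl = refl

  given received : Fin n → ℕ
  given    v = ∑ (nbrs G v) (charge v)
  received v = ∑ (nbrs G v) (λ u → charge u v)

  data Degree (v : Fin n) : Set where
    deg-2 : deg v ≡ 2 → Degree v
    deg-3 : deg v ≡ 3 → Degree v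
    deg-4 : deg v ≡ 4 → Degree v
    deg-5 : deg v ≡ 5 → Degree v

  degree-view : ∀ {u v} → Adj G u v → Degree v
  degree-view {u} {v} a = view refl
    where
      u∈ : u ∈ nbrs G v
      u∈ = ∈-nbrs⁺ G (symAdj G a)
      nonempty : ∀ {xs : List (Fin n)} → u ∈ xs → length xs ≢ 0
      nonempty (here _) ()
      nonempty (there _) ()
      view : ∀ {k} → deg v ≡ k → Degree v
      view {0} eq = contradiction eq (nonempty u∈)
      view {1} eq = contradiction eq (degree≢1 v)
      view {2} eq = deg-2 eq
      view {3} eq = deg-3 eq
      view {4} eq = deg-4 eq
      view {5} eq = deg-5 eq
      view {suc (suc (suc (suc (suc (suc _)))))} eq =
        contradiction (subst (_≤ 5) eq (degree≤5 v)) λ { (s≤s (s≤s (s≤s (s≤s (s≤s ()))))) }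

  charge-5 : ∀ {u v} → deg u ≡ 5 → 13 ≤ charge u v
  charge-5 {u} {v} du = ℕ.≤-trans (ℕ.m≤m+n 13 _) (ℕ.≤-reflexive (sym (charge-at {u} {v} du refl)))

  charge-4 : ∀ {u v} → deg u ≡ 4 → 11 ≤ charge u v
  charge-4 {u} {v} du = ℕ.≤-trans (ℕ.m≤m+n 11 _) (ℕ.≤-reflexive (sym (charge-at {u} {v} du refl)))

  charge-3 : ∀ {u v} → deg u ≡ 3 → deg v ≡ 2 → charge u v ≡ share (deg (other G v u)) u (other G v u)
  charge-3 = charge-at

  charge-2-big : ∀ {v u k} → deg v ≡ 2 → deg u ≡ suc (suc (suc k)) → charge v u ≡ 0
  charge-2-big dv du = charge-at dv du

  charge-2 : ∀ {v u s y} → deg v ≡ 2 → deg u ≡ 2 → other G v u ≡ s → other G u v ≡ y →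
             charge v u ≡ pass (deg s) (deg y)
  charge-2 dv du refl refl = charge-at dv du

  module TwoVertex {v : Fin n} (dv : deg v ≡ 2) where

    -- Since v is in T, the vertices behind u and s have degree 5, so each side passes 6 and v
    -- passes nothing.
    middle : ∀ {u s} → Adj G v u → Adj G v s → s ≢ u → deg u ≡ 2 → deg s ≡ 2 → v ∈ T →
             12 ⊹ (charge v u ⊹ charge v s) ≤ charge u v ⊹ charge s v
    middle {u} {s} vu vs s≢u du ds v∈T
      rewrite charge-2 {v} {u} dv du (other-unique G dv vu vs s≢u) refl
            | charge-2 {v} {s} dv ds (other-unique G dv vs vu (≢-sym s≢u)) refl
            | charge-2 {u} {v} du dv refl (other-unique G dv vu vs s≢u)
            | charge-2 {s} {v} ds dv refl (other-unique G dv vs vu (≢-sym s≢u))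
            | du | ds
            | outer-≡5 du dv (symAdj G vu) (λ u∈T → independent u∈T v∈T (symAdj G vu)) v∈T
            | outer-≡5 ds dv (symAdj G vs) (λ s∈T → independent s∈T v∈T (symAdj G vs)) v∈T = ℕ.≤-refl

    -- The path is u, v, s, y, where s is a 2-vertex; the cases below take u of degree 3, 4 or 5.
    module Half {u s} (vu : Adj G v u) (vs : Adj G v s) (s≢u : s ≢ u) (ds : deg s ≡ 2) where

      y : Fin n
      y = other G s v

      sv = symAdj G vs

      other-u : other G v u ≡ s
      other-u = other-unique G dv vu vs s≢u

      other-s : other G v s ≡ u
      other-s = other-unique G dv vs vu (≢-sym s≢u)

      back : charge v s ≡ pass (deg u) (deg y)
      back = charge-2 dv ds other-s refl

      forth : charge s v ≡ pass (deg y) (deg u)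
      forth = charge-2 ds dv refl other-s

      y-5 : v ∈ T → deg y ≡ 5
      y-5 v∈T = outer-≡5 ds dv sv (λ s∈T → independent v∈T s∈T vs) v∈T

      end : ∀ {k} → deg u ≡ suc (suc (suc k)) → 12 ⊹ charge v s ≤ charge u v ⊹ charge s v →
            12 ⊹ (charge v u ⊹ charge v s) ≤ charge u v ⊹ charge s v
      end du p rewrite charge-2-big {v} {u} dv du = p

      half-5 : deg u ≡ 5 → 12 ⊹ charge v s ≤ charge u v ⊹ charge s v
      half-5 du with deg y ℕ.≟ 2
      ... | yes dy = begin
          12 ⊹ charge v s           ≡⟨ cong (12 ⊹_) (trans back (cong₂ pass du dy)) ⟩
          18                        ≡⟨ cong (λ k → 13 ⊹ 5 · k) (𝟙-yes (End₅? (u , v)) (symAdj G vu , du , dv ,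
                                         trans (cong deg other-u) ds , trans (cong (λ x → deg (other G x v)) other-u) dy)) ⟨
          13 ⊹ 5 · 𝟙 (End₅? (u , v)) ≡⟨ charge-at du dv ⟨
          charge u v                ≤⟨ ℕ.m≤m+n _ _ ⟩
          charge u v ⊹ charge s v   ∎
        where open ℕ.≤-Reasoning
      ... | no dy≢2 = begin
          12 ⊹ charge v s           ≡⟨ cong (12 ⊹_) (trans back (cong (λ d → pass d (deg y)) du)) ⟩
          12 ⊹ pass 5 (deg y)       ≤⟨ ℕ.+-monoʳ-≤ 12 (pass-1 (deg y) dy≢2) ⟩
          13                        ≤⟨ charge-5 {u} {v} du ⟩
          charge u v                ≤⟨ ℕ.m≤m+n _ _ ⟩
          charge u v ⊹ charge s v   ∎
        where
          open ℕ.≤-Reasoning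
          pass-1 : ∀ k → k ≢ 2 → pass 5 k ≤ 1
          pass-1 0 _ = ℕ.≤-refl
          pass-1 1 _ = ℕ.≤-refl
          pass-1 2 2≢2 = contradiction refl 2≢2
          pass-1 (suc (suc (suc _))) _ = ℕ.≤-refl

      half-11 : ∀ {k} → deg u ≡ k → pass k (deg y) ≡ 0 → pass 5 k ≡ 1 → 11 ≤ charge u v → deg y ≡ 5 →
                12 ⊹ charge v s ≤ charge u v ⊹ charge s v
      half-11 du p₀ p₁ 11≤ dy
        rewrite trans back (trans (cong (λ d → pass d (deg y)) du) p₀)
              | trans forth (trans (cong₂ pass dy du) p₁) = ℕ.+-monoˡ-≤ 1 11≤

      half-4 : deg u ≡ 4 → 12 ⊹ charge v s ≤ charge u v ⊹ charge s v
      half-4 du with deg y ℕ.≟ 4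
      ... | yes dy = begin
          12 ⊹ charge v s           ≡⟨ cong (12 ⊹_) (trans back (cong₂ pass du dy)) ⟩
          12                        ≡⟨ cong (λ k → 11 ⊹ 1 · k) (𝟙-yes (End₄? (u , v)) (symAdj G vu , du , dv ,
                                         trans (cong deg other-u) ds , trans (cong (λ x → deg (other G x v)) other-u) dy)) ⟨
          11 ⊹ 1 · 𝟙 (End₄? (u , v)) ≡⟨ charge-at du dv ⟨
          charge u v                ≤⟨ ℕ.m≤m+n _ _ ⟩
          charge u v ⊹ charge s v   ∎
        where open ℕ.≤-Reasoning
      ... | no dy≢4 = half-11 du refl refl (charge-4 {u} {v} du) dy
        where
          dy : deg y ≡ 5
          -- With v in T, saturation at s gives 5. With s in T, saturation at v would make u a
          -- 5-vertex. Otherwise saturation at s gives at least 4, and 4 is excluded.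
          dy with v ∈? T | s ∈? T
          ... | yes v∈T | _       = y-5 v∈T
          ... | no v∉T  | yes s∈T = contradiction
                (trans (sym (outer-≡5 dv ds vs v∉T s∈T)) (trans (cong deg other-s) du)) λ ()
          ... | no v∉T  | no s∉T  = ℕ.≤-antisym (degree≤5 y)
                (ℕ.≤∧≢⇒< (outer-≥4 ds dv sv s∉T) (≢-sym dy≢4))

      -- By `outer-≥4` a 3-vertex u forces v into T, so y has degree 5: u gives 11 and s passes 1.
      half-3 : deg u ≡ 3 → 12 ⊹ charge v s ≤ charge u v ⊹ charge s v
      half-3 du = half-11 du refl refl
          (ℕ.≤-reflexive (sym (trans (charge-3 du dv)
            (cong (λ k → share k u (other G v u)) (trans (cong deg other-u) ds)))))
          (y-5 (decidable-stable (v ∈? T) λ v∉T →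
            contradiction (subst (4 ≤_) (trans (cong deg other-s) du) (outer-≥4 dv ds vs v∉T))
              λ { (s≤s (s≤s (s≤s ()))) }))

    module Big {u s k l} (vu : Adj G v u) (vs : Adj G v s) (s≢u : s ≢ u)
      (du : deg u ≡ suc (suc (suc k))) (ds : deg s ≡ suc (suc (suc l))) where

      nothing-out : 12 ≤ charge u v ⊹ charge s v → 12 ⊹ (charge v u ⊹ charge v s) ≤ charge u v ⊹ charge s v
      nothing-out p rewrite charge-2-big {v} {u} dv du | charge-2-big {v} {s} dv ds = p

      from-u : ∀ {a} → 12 ≤ a → a ≤ charge u v → 12 ⊹ (charge v u ⊹ charge v s) ≤ charge u v ⊹ charge s v
      from-u 12≤a a≤ = nothing-out (ℕ.≤-trans 12≤a (ℕ.≤-trans a≤ (ℕ.m≤m+n _ _)))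

      from-s : ∀ {a} → 12 ≤ a → a ≤ charge s v → 12 ⊹ (charge v u ⊹ charge v s) ≤ charge u v ⊹ charge s v
      from-s 12≤a a≤ = nothing-out (ℕ.≤-trans 12≤a (ℕ.≤-trans a≤ (ℕ.m≤n+m _ (charge u v))))

    share-to : ∀ {u s k} → Adj G v u → Adj G v s → s ≢ u → deg u ≡ 3 → deg s ≡ k → charge u v ≡ share k u s
    share-to {u} {s} vu vs s≢u du ds = trans (charge-3 du dv)
      (cong₂ (λ k x → share k u x) (trans (cong deg (other-unique G dv vu vs s≢u)) ds) (other-unique G dv vu vs s≢u))

    flip : ∀ u s → 12 ⊹ (charge v u ⊹ charge v s) ≤ charge u v ⊹ charge s v →
           12 ⊹ (charge v s ⊹ charge v u) ≤ charge s v ⊹ charge u v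
    flip u s rewrite ℕ.+-comm (charge v u) (charge v s) | ℕ.+-comm (charge u v) (charge s v) = id

    balance : ∀ {u s} → Adj G v u → Adj G v s → s ≢ u →
              12 ⊹ (charge v u ⊹ charge v s) ≤ charge u v ⊹ charge s v
    balance {u} {s} vu vs s≢u with degree-view vu | degree-view vs
    ... | deg-2 du | deg-2 ds = middle vu vs s≢u du ds
          (middle-∈T dv ds vs (trans (cong deg (other-unique G dv vs vu (≢-sym s≢u))) du))
    ... | deg-3 du | deg-2 ds = let open Half vu vs s≢u ds in end du (half-3 du)
    ... | deg-4 du | deg-2 ds = let open Half vu vs s≢u ds in end du (half-4 du)
    ... | deg-5 du | deg-2 ds = let open Half vu vs s≢u ds in end du (half-5 du)
    ... | deg-2 du | deg-3 ds = let open Half vs vu (≢-sym s≢u) du in flip s u (end ds (half-3 ds))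
    ... | deg-2 du | deg-4 ds = let open Half vs vu (≢-sym s≢u) du in flip s u (end ds (half-4 ds))
    ... | deg-2 du | deg-5 ds = let open Half vs vu (≢-sym s≢u) du in flip s u (end ds (half-5 ds))
    ... | deg-5 du | deg-3 ds = Big.from-u vu vs s≢u du ds (ℕ.n≤1+n 12) (charge-5 du)
    ... | deg-5 du | deg-4 ds = Big.from-u vu vs s≢u du ds (ℕ.n≤1+n 12) (charge-5 du)
    ... | deg-5 du | deg-5 ds = Big.from-u vu vs s≢u du ds (ℕ.n≤1+n 12) (charge-5 du)
    ... | deg-3 du | deg-5 ds = Big.from-s vu vs s≢u du ds (ℕ.n≤1+n 12) (charge-5 ds)
    ... | deg-4 du | deg-5 ds = Big.from-s vu vs s≢u du ds (ℕ.n≤1+n 12) (charge-5 ds)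
    ... | deg-4 du | deg-4 ds = Big.nothing-out vu vs s≢u du ds
          (ℕ.≤-trans (ℕ.m≤m+n 12 10) (ℕ.+-mono-≤ (charge-4 {u} {v} du) (charge-4 {s} {v} ds)))
    ... | deg-4 du | deg-3 ds = Big.nothing-out vu vs s≢u du ds
          (ℕ.+-mono-≤ (charge-4 {u} {v} du) (ℕ.≤-reflexive (sym (share-to vs vu (≢-sym s≢u) ds du))))
    ... | deg-3 du | deg-4 ds = Big.nothing-out vu vs s≢u du ds
          (ℕ.+-mono-≤ {1} {_} {11} (ℕ.≤-reflexive (sym (share-to vu vs s≢u du ds))) (charge-4 {s} {v} ds))
    -- Not both are tight: a tight s has only 2-vertices as neighbors, which `tight-clash` forbids
    -- behind a neighbor of a tight u.
    ... | deg-3 du | deg-3 ds = Big.nothing-out vu vs s≢u du ds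
          (subst (12 ≤_) (cong₂ _⊹_ (sym (share-to vu vs s≢u du ds)) (sym (share-to vs vu (≢-sym s≢u) ds du)))
            (share₃-sum (Tight? u) (Tight? s) λ { (tu , ts) → tight-clash tu (symAdj G vu) λ {z} sz →
              proj₁ (All.lookup (proj₂ ts) (∈-nbrs⁺ G (subst (λ x → Adj G x z) (other-unique G dv vu vs s≢u) sz))) }))

  share-≤11 : ∀ k u s → share k u s ≤ 11
  share-≤11 0 u s = z≤n
  share-≤11 1 u s = z≤n
  share-≤11 2 u s = ℕ.≤-refl
  share-≤11 3 u s = ℕ.≤-trans (share₃-≤7 (Tight? u) (Tight? s)) (ℕ.m≤m+n 7 4)
  share-≤11 4 u s = ℕ.m≤m+n 1 10
  share-≤11 (suc (suc (suc (suc (suc k))))) u s = z≤n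

  share-≤7 : ∀ k u s → k ≢ 2 → share k u s ≤ 7
  share-≤7 0 u s _ = z≤n
  share-≤7 1 u s _ = z≤n
  share-≤7 2 u s 2≢2 = contradiction refl 2≢2
  share-≤7 3 u s _ = share₃-≤7 (Tight? u) (Tight? s)
  share-≤7 4 u s _ = ℕ.m≤m+n 1 6
  share-≤7 (suc (suc (suc (suc (suc k))))) u s _ = z≤n

  share-≤6 : ∀ k u s → k ≢ 2 → (k ≡ 3 → ¬ Tight s) → share k u s ≤ 6
  share-≤6 0 u s _ _ = z≤n
  share-≤6 1 u s _ _ = z≤n
  share-≤6 2 u s 2≢2 _ = contradiction refl 2≢2
  share-≤6 3 u s _ ¬ts = share₃-≤6 (Tight? u) (Tight? s) (¬ts refl)
  share-≤6 4 u s _ _ = ℕ.m≤m+n 1 5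
  share-≤6 (suc (suc (suc (suc (suc k))))) u s _ _ = z≤n

  share-≤1 : ∀ k u s → k ≢ 2 → k ≢ 3 → share k u s ≤ 1
  share-≤1 0 u s _ _ = z≤n
  share-≤1 1 u s _ _ = z≤n
  share-≤1 2 u s 2≢2 _ = contradiction refl 2≢2
  share-≤1 3 u s _ 3≢3 = contradiction refl 3≢3
  share-≤1 4 u s _ _ = ℕ.≤-refl
  share-≤1 (suc (suc (suc (suc (suc k))))) u s _ _ = z≤n

  module ThreeVertex {u : Fin n} (du : deg u ≡ 3) where

    T-two : Fin n → Set
    T-two v = deg v ≡ 2 × v ∈ T

    gives-2 : ∀ {v} → deg v ≡ 2 → charge u v ≡ share (deg (other G v u)) u (other G v u)
    gives-2 = charge-3 du

    gives-0 : ∀ {v k} → deg v ≡ suc (suc (suc k)) → charge u v ≡ 0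
    gives-0 dv = charge-at du dv

    far-2 : ∀ {v} → deg v ≡ 2 → Adj G u v → deg (other G v u) ≡ 2 → v ∈ T
    far-2 {v} dv uv ds = decidable-stable (v ∈? T) λ v∉T →
      contradiction (subst (4 ≤_) (trans (cong deg (other-other G dv (symAdj G uv))) du)
        (outer-≥4 dv ds (other-adj G dv (symAdj G uv)) v∉T)) λ { (s≤s (s≤s (s≤s ()))) }

    -- Here u may owe 11 to several 2-neighbors in T. Each of these contributes at most one of the
    -- six square-neighbors of u, so the remaining neighbors must have large degree, and then they
    -- pay u.
    module WithT {t : Fin n} (ut : Adj G u t) (dt : deg t ≡ 2) (t∈T : t ∈ T) where

      u∉T : u ∉ T
      u∉T u∈T = independent u∈T t∈T ut

      weigh : ∀ {a b f k} → a ≤ b → f ≤ k → 2 · a ⊹ 11 · f ≤ 2 · b ⊹ 11 · k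
      weigh a≤b f≤k = ℕ.+-mono-≤ (ℕ.*-monoʳ-≤ 2 a≤b) (ℕ.*-monoʳ-≤ 11 f≤k)

      -- The coefficients are chosen so that, summed over the three neighbors, φ-sum
      -- leaves 2 · given u ≤ 33 ⊹ 2 · received u.
      per-nbr : ∀ {v} → Adj G u v → 2 · charge u v ⊹ 11 · φ u v ≤ 33 ⊹ 2 · charge v u
      per-nbr {v} uv with degree-view uv
      ... | deg-3 dv rewrite gives-0 {v} dv = ℕ.≤-trans
            (weigh {0} {0} z≤n (subst (φ u v ≤_) dv (φ-≤ uv))) (ℕ.m≤m+n 33 _)
      ... | deg-4 dv rewrite gives-0 {v} dv = ℕ.≤-trans
            (weigh {0} {0} z≤n (subst (φ u v ≤_) dv (φ-≤ uv)))
            (ℕ.≤-trans (ℕ.m≤m+n 44 11) (ℕ.+-monoʳ-≤ 33 (ℕ.*-monoʳ-≤ 2 (charge-4 {v} {u} dv))))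
      ... | deg-5 dv rewrite gives-0 {v} dv = ℕ.≤-trans
            (weigh {0} {0} z≤n (subst (φ u v ≤_) dv (φ-≤ uv)))
            (ℕ.≤-trans (ℕ.m≤m+n 55 4) (ℕ.+-monoʳ-≤ 33 (ℕ.*-monoʳ-≤ 2 (charge-5 {v} {u} dv))))
      ... | deg-2 dv with v ∈? T
      ...   | yes v∈T = ℕ.≤-trans
              (weigh {charge u v} (ℕ.≤-trans (ℕ.≤-reflexive (gives-2 dv)) (share-≤11 (deg (other G v u)) u (other G v u)))
                (s≤s⁻¹ (subst (φ u v ≺_) dv (φ-< uv u∉T v∈T (here refl)))))
              (ℕ.m≤m+n 33 _)
      ...   | no v∉T = ℕ.≤-trans
              (weigh {charge u v} (ℕ.≤-trans (ℕ.≤-reflexive (gives-2 dv)) (share-≤1 (deg (other G v u)) u (other G v u) (v∉T ∘ far-2 dv uv) ds≢3))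
                (subst (φ u v ≤_) dv (φ-≤ uv)))
              (ℕ.≤-trans (ℕ.m≤m+n 24 9) (ℕ.m≤m+n 33 _))
        where
          vu = symAdj G uv
          -- As t is in T, at most two square-neighbors of v come through u; a 3-vertex on the other
          -- side adds at most three.
          ds≢3 : deg (other G v u) ≢ 3
          ds≢3 ds = contradiction
            (ℕ.≤-trans (φ-two dv vu v∉T) (ℕ.+-mono-≤
              (s≤s⁻¹ (subst (φ v u ≺_) du (φ-< vu v∉T t∈T (there (∈-nbrs⁺ G ut)))))
              (subst (φ v (other G v u) ≤_) ds (φ-≤ (other-adj G dv vu)))))
            λ { (s≤s (s≤s (s≤s (s≤s (s≤s ()))))) }

      balance : given u ≤ 17 ⊹ received u
      balance = ℕ.≮⇒≥ λ lt → ℕ.<-irrefl refl (begin-strict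
          2 · given u ⊹ 11 · 6                        ≤⟨ ℕ.+-monoʳ-≤ _ (ℕ.*-monoʳ-≤ 11 (φ-sum u∉T)) ⟩
          2 · given u ⊹ 11 · ∑ (nbrs G u) (φ u)       ≡⟨ cong₂ _⊹_ (∑-* 2 (charge u) (nbrs G u)) (∑-* 11 (φ u) (nbrs G u)) ⟨
          ∑ (nbrs G u) (λ v → 2 · charge u v) ⊹ ∑ (nbrs G u) (λ v → 11 · φ u v)
                                                      ≡⟨ ∑-+ (λ v → 2 · charge u v) (λ v → 11 · φ u v) (nbrs G u) ⟨
          ∑ (nbrs G u) (λ v → 2 · charge u v ⊹ 11 · φ u v)
                                                      ≤⟨ ∑-All (All.tabulate (λ v∈ → per-nbr (∈-nbrs⁻ G v∈))) ⟩
          ∑ (nbrs G u) (λ v → 33 ⊹ 2 · charge v u)    ≡⟨ ∑-affine 33 2 (λ v → charge v u) (nbrs G u) ⟩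
          deg u · 33 ⊹ 2 · received u                 ≡⟨ cong (λ d → d · 33 ⊹ 2 · received u) {deg u} {3} du ⟩
          99 ⊹ 2 · received u                         <⟨ ℕ.m<n+m _ {3} (s≤s z≤n) ⟩
          102 ⊹ 2 · received u
            ≡⟨ solve 1 (λ r → con 102 :+ con 2 :* r := con 2 :* (con 1 :+ (con 17 :+ r)) :+ con 66) refl (received u) ⟩
          2 · suc (17 ⊹ received u) ⊹ 66              ≤⟨ ℕ.+-monoˡ-≤ 66 (ℕ.*-monoʳ-≤ 2 lt) ⟩
          2 · given u ⊹ 66                            ∎)
        where
          open ℕ.≤-Reasoning
          open +-*-Solver

    module WithoutT (none : ∀ {v} → Adj G u v → ¬ T-two v) where

      far≢2 : ∀ {v} → deg v ≡ 2 → Adj G u v → deg (other G v u) ≢ 2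
      far≢2 dv uv ds = none uv (dv , far-2 dv uv ds)

      gives-≤7 : ∀ {v} → Adj G u v → charge u v ≤ 7
      gives-≤7 {v} uv with degree-view uv
      ... | deg-2 dv = ℕ.≤-trans (ℕ.≤-reflexive (gives-2 dv)) (share-≤7 (deg (other G v u)) u (other G v u) (far≢2 dv uv))
      ... | deg-3 dv = ℕ.≤-trans (ℕ.≤-reflexive (gives-0 {v} dv)) z≤n
      ... | deg-4 dv = ℕ.≤-trans (ℕ.≤-reflexive (gives-0 {v} dv)) z≤n
      ... | deg-5 dv = ℕ.≤-trans (ℕ.≤-reflexive (gives-0 {v} dv)) z≤n

      all-nbrs : ∀ {P : Fin n → Set} → (∀ {v} → Adj G u v → P v) → All P (nbrs G u)
      all-nbrs p = All.tabulate (p ∘ ∈-nbrs⁻ G)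

      three : ∀ b → deg u · b ≡ 3 · b
      three b = cong (_· b) du

      -- At most 5 + 5 + 5 if u is tight, and 7 + 7 + 0 if some neighbor is not a 2-vertex.
      -- Otherwise 6 + 6 + 1: no 7 occurs, as a tight vertex behind a neighbor would clash with u,
      -- and some neighbor does not lead to a 3-vertex.
      balance : given u ≤ 17
      balance with Tight? u
      ... | yes tu = ℕ.≤-trans (∑-bound {b = 5} (All.map gives-≤5 (proj₂ tu)))
              (ℕ.≤-trans (ℕ.≤-reflexive (three 5)) (ℕ.m≤m+n 15 2))
        where
          gives-≤5 : ∀ {v} → deg v ≡ 2 × deg (other G v u) ≡ 3 → charge u v ≤ 5
          gives-≤5 {v} (dv , ds) = ℕ.≤-trans
            (ℕ.≤-reflexive (trans (gives-2 dv) (cong (λ k → share k u (other G v u)) ds))) (share₃-yes (Tight? u) (Tight? (other G v u)) tu)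
      ... | no ¬tu with All.all? (λ v → deg v ℕ.≟ 2) (nbrs G u)
      ...   | no ¬all = ℕ.+-cancelˡ-≤ 7 _ _ (ℕ.≤-trans
              (∑-bound-one {a = 0} {b = 7} (all-nbrs gives-≤7) (find-big (Allₚ.¬All⇒Any¬ (λ v → deg v ℕ.≟ 2) _ ¬all)))
              (ℕ.≤-trans (ℕ.≤-reflexive (three 7)) (ℕ.m≤m+n 21 3)))
        where
          not-2 : ∀ {v} → Adj G u v → deg v ≢ 2 → charge u v ≤ 0
          not-2 {v} uv dv≢2 with degree-view uv
          ... | deg-2 dv = contradiction dv dv≢2
          ... | deg-3 dv = ℕ.≤-reflexive (gives-0 {v} dv)
          ... | deg-4 dv = ℕ.≤-reflexive (gives-0 {v} dv)
          ... | deg-5 dv = ℕ.≤-reflexive (gives-0 {v} dv)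
          find-big : Any (λ v → deg v ≢ 2) (nbrs G u) → Any (λ v → charge u v ≤ 0) (nbrs G u)
          find-big any with find any
          ... | v , v∈ , dv≢2 = lose v∈ (not-2 (∈-nbrs⁻ G v∈) dv≢2)
      ...   | yes all = ℕ.+-cancelˡ-≤ 6 _ _ (ℕ.≤-trans
              (∑-bound-one {a = 1} {b = 6} (all-nbrs gives-≤6) (find-small (Allₚ.¬All⇒Any¬ (λ v → deg (other G v u) ℕ.≟ 3) _ not-all)))
              (ℕ.≤-trans (s≤s (ℕ.≤-reflexive (three 6))) (ℕ.m≤m+n 19 4)))
        where
          two : ∀ {v} → Adj G u v → deg v ≡ 2
          two uv = All.lookup all (∈-nbrs⁺ G uv)
          gives-≤6 : ∀ {v} → Adj G u v → charge u v ≤ 6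
          gives-≤6 {v} uv = ℕ.≤-trans (ℕ.≤-reflexive (gives-2 dv)) (share-≤6 (deg (other G v u)) u (other G v u) (far≢2 dv uv) λ _ ts →
              tight-clash ts (symAdj G (other-adj G dv (symAdj G uv)))
                λ {z} a → two (subst (λ x → Adj G x z) (other-other G dv (symAdj G uv)) a))
            where dv = two uv
          not-all : ¬ All (λ v → deg (other G v u) ≡ 3) (nbrs G u)
          not-all all-3 = ¬tu (du , All.zip (all , all-3))
          find-small : Any (λ v → deg (other G v u) ≢ 3) (nbrs G u) → Any (λ v → charge u v ≤ 1) (nbrs G u)
          find-small any with find any
          ... | v , v∈ , ds≢3 = lose v∈ (ℕ.≤-trans (ℕ.≤-reflexive (gives-2 dv)) (share-≤1 (deg (other G v u)) u (other G v u) (far≢2 dv (∈-nbrs⁻ G v∈)) ds≢3))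
            where dv = two (∈-nbrs⁻ G v∈)

    balance : given u ≤ 17 ⊹ received u
    balance with Any.any? (λ v → deg v ℕ.≟ 2 ×-dec v ∈? T) (nbrs G u)
    ... | yes any = let t , t∈ , dt , t∈T = find any in WithT.balance (∈-nbrs⁻ G t∈) dt t∈T
    ... | no none = ℕ.≤-trans (WithoutT.balance λ uv p → none (lose (∈-nbrs⁺ G uv) p)) (ℕ.m≤m+n 17 _)

-- Summing the charges over the graph

∑-strict : ∀ {f g : X → ℕ} {x xs} → (∀ y → f y ≤ g y) → x ∈ xs → f x ≺ g x → ∑ xs f ≺ ∑ xs g
∑-strict {xs = _ ∷ xs} f≤g (here refl) lt = ℕ.+-mono-<-≤ lt (∑-mono xs f≤g)
∑-strict {xs = y ∷ xs} f≤g (there x∈)  lt = ℕ.+-mono-≤-< (f≤g y) (∑-strict f≤g x∈ lt)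

totalDegree nonIsolated : ∀ {n} → Graph n → ℕ
totalDegree {n} G = ∑ (allFin n) (degree G)
nonIsolated {n} G = ∑ (allFin n) (positive ∘ degree G)

module Total {n : ℕ} {G : Graph n} (critical : Critical G) where

  open Structure critical
  open Discharging critical

  V : List (Fin n)
  V = allFin n

  five four ends-5 ends-4 : Fin n → ℕ
  five   v = 𝟙 (deg v ℕ.≟ 5)
  four   v = 𝟙 (deg v ℕ.≟ 4)
  ends-5 v = ∑ V (λ a → 𝟙 (End₅? (v , a)))
  ends-4 v = ∑ V (λ a → 𝟙 (End₄? (v , a)))

  two-balance : ∀ {v} → deg v ≡ 2 → 12 ⊹ given v ≤ received v
  two-balance {v} dv = go (nbrs G v) (∈-nbrs⁻ G) dv (nbrs-unique G v)
    where
      go : ∀ xs → (∀ {u} → u ∈ xs → Adj G v u) → length xs ≡ 2 → Unique xs →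
           12 ⊹ ∑ xs (charge v) ≤ ∑ xs (λ u → charge u v)
      go (u ∷ s ∷ []) adj refl ((u≢s ∷ []) ∷ _)
        rewrite ℕ.+-identityʳ (charge v s) | ℕ.+-identityʳ (charge s v) =
        TwoVertex.balance dv (adj 1st) (adj 2nd) (≢-sym u≢s)

  given-5 : ∀ {v} → deg v ≡ 5 → given v ≤ 65 ⊹ 5 · ends-5 v
  given-5 {v} dv = begin
      given v                                                ≡⟨ ∑-cong (nbrs G v) (λ u → charge-at {v} {u} dv refl) ⟩
      ∑ (nbrs G v) (λ u → 13 ⊹ 5 · 𝟙 (End₅? (v , u)))        ≡⟨ ∑-affine 13 5 (λ u → 𝟙 (End₅? (v , u))) (nbrs G v) ⟩
      deg v · 13 ⊹ 5 · ∑ (nbrs G v) (λ u → 𝟙 (End₅? (v , u))) ≡⟨ cong (λ d → d · 13 ⊹ 5 · ∑ (nbrs G v) (λ u → 𝟙 (End₅? (v , u)))) {deg v} {5} dv ⟩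
      65 ⊹ 5 · ∑ (nbrs G v) (λ u → 𝟙 (End₅? (v , u)))
        ≤⟨ ℕ.+-monoʳ-≤ 65 (ℕ.*-monoʳ-≤ 5 (∑-filter-≤ (adj? G v) (λ u → 𝟙 (End₅? (v , u))) V)) ⟩
      65 ⊹ 5 · ends-5 v                                      ∎
    where open ℕ.≤-Reasoning

  given-4 : ∀ {v} → deg v ≡ 4 → given v ≤ 44 ⊹ 1 · ends-4 v
  given-4 {v} dv = begin
      given v                                                ≡⟨ ∑-cong (nbrs G v) (λ u → charge-at {v} {u} dv refl) ⟩
      ∑ (nbrs G v) (λ u → 11 ⊹ 1 · 𝟙 (End₄? (v , u)))        ≡⟨ ∑-affine 11 1 (λ u → 𝟙 (End₄? (v , u))) (nbrs G v) ⟩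
      deg v · 11 ⊹ 1 · ∑ (nbrs G v) (λ u → 𝟙 (End₄? (v , u))) ≡⟨ cong (λ d → d · 11 ⊹ 1 · ∑ (nbrs G v) (λ u → 𝟙 (End₄? (v , u)))) {deg v} {4} dv ⟩
      44 ⊹ 1 · ∑ (nbrs G v) (λ u → 𝟙 (End₄? (v , u)))
        ≤⟨ ℕ.+-monoʳ-≤ 44 (ℕ.*-monoʳ-≤ 1 (∑-filter-≤ (adj? G v) (λ u → 𝟙 (End₄? (v , u))) V)) ⟩
      44 ⊹ 1 · ends-4 v                                      ∎
    where open ℕ.≤-Reasoning

  -- Free of subtraction: the final weight, increased by 5 and 1 for the ends at v of the two kinds,
  -- is at least 10 at a 5-vertex, 2 at a 4-vertex and 0 elsewhere. The factor `positive d` gives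
  -- isolated vertices weight 0.
  Local : ℕ → Fin n → Set
  Local d v = 70 · positive d ⊹ given v ⊹ (10 · 𝟙 (d ℕ.≟ 5) ⊹ 2 · 𝟙 (d ℕ.≟ 4)) ≤
              29 · d ⊹ received v ⊹ (5 · ends-5 v ⊹ 1 · ends-4 v)

  empty-sum : ∀ {xs : List X} {f : X → ℕ} → length xs ≡ 0 → ∑ xs f ≡ 0
  empty-sum {xs = []} _ = refl

  local-at : ∀ d v → deg v ≡ d → Local d v
  local-at 0 v dv rewrite empty-sum {xs = nbrs G v} {charge v} dv = z≤n
  local-at 1 v dv = contradiction dv (degree≢1 v)
  local-at 2 v dv = ℕ.≤-trans (ℕ.≤-reflexive (ℕ.+-identityʳ (70 ⊹ given v)))
    (ℕ.≤-trans (ℕ.+-monoʳ-≤ 58 (two-balance dv)) (ℕ.m≤m+n _ _))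
  local-at 3 v dv = ℕ.≤-trans (ℕ.≤-reflexive (ℕ.+-identityʳ (70 ⊹ given v)))
    (ℕ.≤-trans (ℕ.+-monoʳ-≤ 70 (ThreeVertex.balance dv)) (ℕ.m≤m+n _ _))
  local-at 4 v dv = begin
      70 ⊹ given v ⊹ 2                          ≤⟨ ℕ.+-monoˡ-≤ 2 (ℕ.+-monoʳ-≤ 70 (given-4 dv)) ⟩
      70 ⊹ (44 ⊹ 1 · ends-4 v) ⊹ 2              ≡⟨ ℕ.+-comm (114 ⊹ 1 · ends-4 v) 2 ⟩
      116 ⊹ 1 · ends-4 v                        ≤⟨ ℕ.+-mono-≤ (ℕ.m≤m+n 116 (received v)) (ℕ.m≤n+m _ (5 · ends-5 v)) ⟩
      116 ⊹ received v ⊹ (5 · ends-5 v ⊹ 1 · ends-4 v) ∎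
    where open ℕ.≤-Reasoning
  local-at 5 v dv = begin
      70 ⊹ given v ⊹ 10                         ≤⟨ ℕ.+-monoˡ-≤ 10 (ℕ.+-monoʳ-≤ 70 (given-5 dv)) ⟩
      70 ⊹ (65 ⊹ 5 · ends-5 v) ⊹ 10             ≡⟨ ℕ.+-comm (135 ⊹ 5 · ends-5 v) 10 ⟩
      145 ⊹ 5 · ends-5 v                        ≤⟨ ℕ.+-mono-≤ (ℕ.m≤m+n 145 (received v)) (ℕ.m≤m+n _ (1 · ends-4 v)) ⟩
      145 ⊹ received v ⊹ (5 · ends-5 v ⊹ 1 · ends-4 v) ∎
    where open ℕ.≤-Reasoning
  local-at (suc (suc (suc (suc (suc (suc d)))))) v dv =
    contradiction (subst (_≤ 5) dv (degree≤5 v)) λ { (s≤s (s≤s (s≤s (s≤s (s≤s ()))))) }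

  ends-sum : ∀ (system : EndSystem) k → (∀ {e} → EndSystem.End system e → deg (proj₁ e) ≡ k) →
             ∑ V (λ v → ∑ V (λ a → 𝟙 (EndSystem.End? system (v , a)))) ≤ 2 · ∑ V (λ v → 𝟙 (deg v ℕ.≟ k))
  ends-sum system k hub-deg = begin
      ∑ V (λ v → ∑ V (λ a → 𝟙 (End? (v , a))))   ≡⟨ ∑-product (𝟙 ∘ End?) V V ⟨
      ∑ (cartesianProduct V V) (𝟙 ∘ End?)         ≡⟨ length-filter-∑ End? (cartesianProduct V V) ⟨
      length P                                    ≤⟨ Forest.ends-≤ critical system (length W) W ℕ.≤-refl P-unique
                                                       P⁻ (λ p → P⁺ (π-End (P⁻ p))) (λ p → W⁺ (hub-deg (P⁻ p))) ⟩
      2 · length W                                ≡⟨ cong (2 ·_) (length-filter-∑ (λ v → deg v ℕ.≟ k) V) ⟩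
      2 · ∑ V (λ v → 𝟙 (deg v ℕ.≟ k))             ∎
    where
      open ℕ.≤-Reasoning
      open EndSystem system
      P = filter End? (cartesianProduct V V)
      W = filter (λ v → deg v ℕ.≟ k) V
      P-unique : Unique P
      P-unique = Unique.filter⁺ End? (Unique.cartesianProduct⁺ (Unique.allFin⁺ n) (Unique.allFin⁺ n))
      P⁻ : ∀ {e} → e ∈ P → End e
      P⁻ p = proj₂ (∈-filter⁻ End? {xs = cartesianProduct V V} p)
      P⁺ : ∀ {e} → End e → e ∈ P
      P⁺ {w , a} end = ∈-filter⁺ End? (∈-cartesianProduct⁺ (∈-allFin w) (∈-allFin a)) end
      W⁺ : ∀ {w} → deg w ≡ k → w ∈ W
      W⁺ {w} dw = ∈-filter⁺ (λ v → deg v ℕ.≟ k) (∈-allFin w) dw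

  given-received : ∑ V given ≡ ∑ V received
  given-received = begin
      ∑ V given                                    ≡⟨ ∑-cong V (λ v → ∑-filter (adj? G v) (charge v) V) ⟩
      ∑ V (λ v → ∑ V (λ u → if does (adj? G v u) then charge v u else 0))
                                                   ≡⟨ ∑-swap (λ v u → if does (adj? G v u) then charge v u else 0) V V ⟩
      ∑ V (λ u → ∑ V (λ v → if does (adj? G v u) then charge v u else 0))
        ≡⟨ ∑-cong V (λ u → ∑-cong V (λ v → cong (if_then charge v u else 0) (does-sym v u))) ⟩
      ∑ V (λ u → ∑ V (λ v → if does (adj? G u v) then charge v u else 0))
                                                   ≡⟨ ∑-cong V (λ u → ∑-filter (adj? G u) (λ v → charge v u) V) ⟨
      ∑ V received                                 ∎
    where
      open ≡-Reasoning
      does-sym : ∀ u v → does (adj? G u v) ≡ does (adj? G v u)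
      does-sym u v with adj? G u v | adj? G v u
      ... | yes _ | yes _ = refl
      ... | no _  | no _  = refl
      ... | yes a | no ¬a = contradiction (symAdj G a) ¬a
      ... | no ¬a | yes a = contradiction (symAdj G a) ¬a

  ∑-weights : ∀ a b c (f g h k : Fin n → ℕ) →
              ∑ V (λ v → a · f v ⊹ g v ⊹ (b · h v ⊹ c · k v)) ≡ a · ∑ V f ⊹ ∑ V g ⊹ (b · ∑ V h ⊹ c · ∑ V k)
  ∑-weights a b c f g h k = trans (∑-+ (λ v → a · f v ⊹ g v) (λ v → b · h v ⊹ c · k v) V)
    (cong₂ _⊹_ (trans (∑-+ (λ v → a · f v) g V) (cong (_⊹ ∑ V g) (∑-* a f V)))
               (trans (∑-+ (λ v → b · h v) (λ v → c · k v) V) (cong₂ _⊹_ (∑-* b h V) (∑-* c k V))))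

  -- Gifts cancel in the sum. With at most two ends per hub on average, the 5 and 1 per end amount
  -- to no more than the 10 and 2 per hub.
  dense : 70 · nonIsolated G ≤ 29 · totalDegree G
  dense = ℕ.+-cancelʳ-≤ (∑ V given) _ _ (ℕ.+-cancelʳ-≤ (10 · ∑ V five ⊹ 2 · ∑ V four) _ _ (begin
      70 · nonIsolated G ⊹ ∑ V given ⊹ (10 · ∑ V five ⊹ 2 · ∑ V four)
        ≡⟨ ∑-weights 70 10 2 (positive ∘ deg) given five four ⟨
      ∑ V (λ v → 70 · positive (deg v) ⊹ given v ⊹ (10 · five v ⊹ 2 · four v))
        ≤⟨ ∑-mono V (λ v → local-at (deg v) v refl) ⟩
      ∑ V (λ v → 29 · deg v ⊹ received v ⊹ (5 · ends-5 v ⊹ 1 · ends-4 v))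
        ≡⟨ ∑-weights 29 5 1 deg received ends-5 ends-4 ⟩
      29 · totalDegree G ⊹ ∑ V received ⊹ (5 · ∑ V ends-5 ⊹ 1 · ∑ V ends-4)
        ≡⟨ cong (λ r → 29 · totalDegree G ⊹ r ⊹ (5 · ∑ V ends-5 ⊹ 1 · ∑ V ends-4)) given-received ⟨
      29 · totalDegree G ⊹ ∑ V given ⊹ (5 · ∑ V ends-5 ⊹ 1 · ∑ V ends-4)
        ≤⟨ ℕ.+-monoʳ-≤ (29 · totalDegree G ⊹ ∑ V given) (ℕ.+-mono-≤
             (ℕ.*-monoʳ-≤ 5 (ends-sum ends₅ 5 (λ e → proj₁ (proj₂ e))))
             (ℕ.*-monoʳ-≤ 1 (ends-sum ends₄ 4 (λ e → proj₁ (proj₂ e))))) ⟩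
      29 · totalDegree G ⊹ ∑ V given ⊹ (5 · (2 · ∑ V five) ⊹ 1 · (2 · ∑ V four))
        ≡⟨ cong (29 · totalDegree G ⊹ ∑ V given ⊹_) (cong₂ _⊹_ (sym (ℕ.*-assoc 5 2 (∑ V five))) (sym (ℕ.*-assoc 1 2 (∑ V four)))) ⟩
      29 · totalDegree G ⊹ ∑ V given ⊹ (10 · ∑ V five ⊹ 2 · ∑ V four) ∎))
    where open ℕ.≤-Reasoning

-- The induction on edges

_⊆ᴳ_ : ∀ {n} → Graph n → Graph n → Set
G′ ⊆ᴳ G = ∀ {u v} → Adj G′ u v → Adj G u v

-- The average degree without the isolated vertices is below 70/29 = 2 + 12/29.
Sparse : ∀ {n} → Graph n → Set
Sparse G = ∀ {u v} → Adj G u v → 29 · totalDegree G ≺ 70 · nonIsolated G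

module _ {n : ℕ} {G : Graph n} where

  degree-mono : ∀ {G′} → G′ ⊆ᴳ G → ∀ v → degree G′ v ≤ degree G v
  degree-mono {G′} sub v = Unique-⊆-length (nbrs-unique G′ v) (λ p → ∈-nbrs⁺ G (sub (∈-nbrs⁻ G′ p)))

  totalDegree-delete : ∀ {a b} → Adj G a b → totalDegree (delete G a b) ≺ totalDegree G
  totalDegree-delete {a} {b} ab = ∑-strict (degree-mono {delete G a b} proj₁) (∈-allFin a)
    (ℕ.≤-<-trans (Unique-⊆-length (nbrs-unique (delete G a b) a) shrink) (length-remove (∈-nbrs⁺ G ab)))
    where
      shrink : ∀ {z} → z ∈ nbrs (delete G a b) a → z ∈ remove b (nbrs G a)
      shrink z∈ with ∈-nbrs⁻ (delete G a b) z∈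
      ... | az , ¬ab = ∈-remove⁺ (∈-nbrs⁺ G az) λ { refl → ¬ab (inj₁ (refl , refl)) }

module _ {n : ℕ} (L : Fin n → List ℕ) (L-unique : ∀ v → Unique (L v)) (L-length : ∀ v → 6 ≤ length (L v)) where

  -- The negated conclusion supplies the uncolorability that `Critical` requires. Sparsity is
  -- assumed of all subgraphs so that it passes to `delete G a b`; the total degree is the measure.
  ¬¬colorable : ∀ k (G : Graph n) → totalDegree G ≺ k → (∀ v → degree G v ≤ 5) →
                (∀ {G′} → G′ ⊆ᴳ G → Sparse G′) → ¬ ¬ LColoring (square G) L
  ¬¬colorable zero    G () _ _
  ¬¬colorable (suc k) G (s≤s total≤k) degree≤5 sparse ¬col = contradict edge
    where
      open Partial G L

      uncolorable : ¬ Coloring []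
      uncolorable κ = ¬col (c κ , (λ v → c∈ κ λ ()) , c≢ κ (λ ()) (λ ()))

      deletable : ∀ {a b} → Adj G a b → ¬ ¬ LColoring (square (delete G a b)) L
      deletable {a} {b} ab = ¬¬colorable k (delete G a b) (ℕ.<-≤-trans (totalDegree-delete {G = G} ab) total≤k)
        (λ v → ℕ.≤-trans (degree-mono {G = G} {delete G a b} proj₁ v) (degree≤5 v))
        (λ {G′} sub → sparse {G′} (proj₁ ∘ sub))

      inside : ∀ U {u v} → u ∈ U → v ∈ U → Adj G u v → ¬ ¬ Coloring U
      inside U u∈ v∈ uv ¬κ = deletable uv (λ col → ¬κ (restore G _ _ u∈ (inj₁ v∈) col))

      -- The edge at a leaf v affects no pair of vertices other than v, so the induction colors all
      -- but v. Its square-neighbors are u and the other neighbors of u, at most five.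
      degree≢1 : ∀ v → degree G v ≢ 1
      degree≢1 v = go (nbrs G v) (λ p → ∈-nbrs⁻ G p) (∈-nbrs⁺ G)
        where
          go : ∀ xs → (∀ {u} → u ∈ xs → Adj G v u) → (∀ {u} → Adj G v u → u ∈ xs) → length xs ≢ 1
          go (u ∷ []) xs⁻ xs⁺ refl = deletable vu λ col →
            uncolorable (greedy L-unique L-length few (restore G _ _ 1st (inj₂ leaf) col))
            where
              vu = xs⁻ 1st
              leaf : ∀ {z} → Adj G v z → z ≡ u
              leaf vz with xs⁺ vz
              ... | here z≡u = z≡u
              cov : Covers [] v (u ∷ remove v (nbrs G u))
              cov _ vz@(v≢z , _) with square⁻ G vz
              ... | inj₁ a = here (leaf a)
              ... | inj₂ (w , a , b) with leaf a
              ...   | refl = there (∈-remove⁺ (∈-nbrs⁺ G b) (≢-sym v≢z))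
              few : length (outer [] v) ≤ 5
              few = ℕ.≤-trans (outer-length (u ∷ remove v (nbrs G u)) cov)
                (ℕ.≤-trans (length-remove (∈-nbrs⁺ G (symAdj G vu))) (degree≤5 u))

      saturation = saturate L-unique L-length (suc n) {[]} [] (s≤s (ℕ.m≤m+n n 0)) uncolorable
      T = proj₁ saturation

      saturated : ∀ {v} → v ∉ T → 6 ≤ length (outer T v)
      saturated = proj₁ (proj₂ saturation)

      critical : Critical G
      critical = record
        { L = L ; T = T ; L-unique = L-unique ; L-length = L-length ; degree≤5 = degree≤5
        ; degree≢1 = degree≢1 ; saturated = saturated
        ; independent = λ u∈ v∈ uv → inside T u∈ v∈ uv (proj₂ (proj₂ saturation))
        ; inside = inside ; uncolorable = uncolorable ; T-uncolorable = proj₂ (proj₂ saturation) }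

      -- If T contained all vertices, a coloring outside T would be vacuous. A vertex outside T has
      -- square-neighbors, hence an edge, and so `Sparse` applies in `contradict`.
      edge : ∃ λ v → v ∉ T
      edge = Finₚ.¬∀⟶∃¬ n (_∈ T) (_∈? T) λ all → proj₂ (proj₂ saturation) record
        { c = λ _ → 0 ; c∈ = λ {v} v∉ → contradiction (all v) v∉ ; c≢ = λ {u} u∉ → contradiction (all u) u∉ }

      contradict : ¬ ∃ λ v → v ∉ T
      contradict (v , v∉T) = go (outer T v) (λ p → proj₂ (∈-outer⁻ {T} p)) (saturated v∉T)
        where
          too-dense : ∀ {a b} → ¬ Adj G a b
          too-dense ab = ℕ.<⇒≱ (sparse {G} id ab) (Total.dense critical)
          go : ∀ xs → (∀ {u} → u ∈ xs → Adj H v u) → ¬ 6 ≤ length xs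
          go (u ∷ _) xs⁻ _ with square⁻ G (xs⁻ 1st)
          ... | inj₁ a           = too-dense a
          ... | inj₂ (_ , a , _) = too-dense a

-- From the maximum average degree to sparsity

∈-sublists-filter : ∀ {P Q : X → Set} (P? : Decidable₁ P) (Q? : Decidable₁ Q) → (∀ {x} → P x → Q x) →
                    ∀ xs → filter P? xs ∈ sublists (filter Q? xs)
∈-sublists-filter P? Q? P⇒Q [] = here refl
∈-sublists-filter P? Q? P⇒Q (x ∷ xs) with P? x | Q? x
... | yes p | no ¬q = contradiction (P⇒Q p) ¬q
... | yes _ | yes _ = ∈-++⁺ˡ (∈-map⁺ (x ∷_) (∈-sublists-filter P? Q? P⇒Q xs))
... | no _  | yes _ = ∈-++⁺ʳ (map (x ∷_) (sublists (filter Q? xs))) (∈-sublists-filter P? Q? P⇒Q xs)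
... | no _  | no _  = ∈-sublists-filter P? Q? P⇒Q xs

filter-∈-sublists : ∀ {P : X → Set} (P? : Decidable₁ P) xs → filter P? xs ∈ sublists xs
filter-∈-sublists P? [] = here refl
filter-∈-sublists P? (x ∷ xs) with does (P? x)
... | true  = ∈-++⁺ˡ (∈-map⁺ (x ∷_) (filter-∈-sublists P? xs))
... | false = ∈-++⁺ʳ (map (x ∷_) (sublists xs)) (filter-∈-sublists P? xs)

𝟙-split : ∀ {P Q A B : Set} (p? : Dec P) (q? : Dec Q) (a? : Dec A) (b? : Dec B) →
          (A → B) → (B → A) → (A → P ⊎ Q) → ¬ (P × Q) → 𝟙 a? ≡ 𝟙 (p? ×-dec a?) ⊹ 𝟙 (q? ×-dec b?)
𝟙-split (yes p) (yes q) _ _ _ _ _ ¬pq = contradiction (p , q) ¬pq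
𝟙-split (no ¬p) (no ¬q) (yes a) _ _ _ or _ = [ (λ p → contradiction p ¬p) , (λ q → contradiction q ¬q) ]′ (or a)
𝟙-split (no _)  (no _)  (no _)  _ _ _ _ _ = refl
𝟙-split (yes _) (no _)  (yes _) _ _ _ _ _ = refl
𝟙-split (yes _) (no _)  (no _)  _ _ _ _ _ = refl
𝟙-split (no _)  (yes _) (yes _) (yes _) _ _ _ _ = refl
𝟙-split (no _)  (yes _) (no _)  (no _)  _ _ _ _ = refl
𝟙-split (no _)  (yes _) (yes a) (no ¬b) a⇒b _ _ _ = contradiction (a⇒b a) ¬b
𝟙-split (no _)  (yes _) (no ¬a) (yes b) _ b⇒a _ _ = contradiction (b⇒a b) ¬a

module _ {n : ℕ} (G : Graph n) where

  forward? : ∀ e → Dec (proj₁ e Fin.< proj₂ e × Adj G (proj₁ e) (proj₂ e))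
  forward? e = (proj₁ e Finₚ.<? proj₂ e) ×-dec adj? G (proj₁ e) (proj₂ e)

  handshake : 2 · length (edges G) ≡ totalDegree G
  handshake = sym (begin
      ∑ V (degree G)
        ≡⟨ ∑-cong V (λ u → length-filter-∑ (adj? G u) V) ⟩
      ∑ V (λ u → ∑ V (λ v → 𝟙 (adj? G u v)))
        ≡⟨ ∑-cong V (λ u → ∑-cong V (λ v → 𝟙-split (u Finₚ.<? v) (v Finₚ.<? u) (adj? G u v) (adj? G v u)
             (symAdj G) (symAdj G) (λ a → order (λ { refl → irrefl G refl a })) (λ (p , q) → Finₚ.<-asym p q))) ⟩
      ∑ V (λ u → ∑ V (λ v → 𝟙 (forward? (u , v)) ⊹ 𝟙 (forward? (v , u))))
        ≡⟨ ∑-cong V (λ u → ∑-+ (λ v → 𝟙 (forward? (u , v))) (λ v → 𝟙 (forward? (v , u))) V) ⟩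
      ∑ V (λ u → ∑ V (λ v → 𝟙 (forward? (u , v))) ⊹ ∑ V (λ v → 𝟙 (forward? (v , u))))
        ≡⟨ ∑-+ (λ u → ∑ V (λ v → 𝟙 (forward? (u , v)))) (λ u → ∑ V (λ v → 𝟙 (forward? (v , u)))) V ⟩
      ∑ V (λ u → ∑ V (λ v → 𝟙 (forward? (u , v)))) ⊹ ∑ V (λ u → ∑ V (λ v → 𝟙 (forward? (v , u))))
        ≡⟨ cong₂ _⊹_ size (trans (∑-swap (λ u v → 𝟙 (forward? (v , u))) V V) size) ⟩
      length (edges G) ⊹ length (edges G)
        ≡⟨ cong (length (edges G) ⊹_) (ℕ.+-identityʳ _) ⟨
      2 · length (edges G) ∎)
    where
      open ≡-Reasoning
      V = allFin n
      order : ∀ {u v : Fin n} → u ≢ v → u Fin.< v ⊎ v Fin.< u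
      order {u} {v} u≢v with Finₚ.<-cmp u v
      ... | tri< u<v _ _ = inj₁ u<v
      ... | tri≈ _ u≡v _ = contradiction u≡v u≢v
      ... | tri> _ _ v<u = inj₂ v<u
      size : ∑ V (λ u → ∑ V (λ v → 𝟙 (forward? (u , v)))) ≡ length (edges G)
      size = sym (trans (length-filter-∑ forward? (cartesianProduct V V)) (∑-product (𝟙 ∘ forward?) V V))

averageDegree-< : ∀ {n} {v : Fin n} vs es → v ∈ vs → averageDegree (vs , es) < (+ 2 / 1) + (+ 12 / 29) →
                  29 · (2 · length es) ≺ 70 · length vs
averageDegree-< (x ∷ xs) es _ avg< = ℤₚ.drop‿+<+ (begin-strict
    + (29 · (2 · length es))                ≡⟨ cong +_ (ℕ.*-comm 29 (2 · length es)) ⟩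
    + ((2 · length es) · 29)                ≡⟨ ℤₚ.pos-* (2 · length es) 29 ⟩
    -- The average degree is stored in lowest terms. `toℚᵘ-fromℚᵘ` goes back to the unreduced
    -- fraction, where comparison with 70/29 is cross-multiplication.
    + (2 · length es) ℤ.* + 29              <⟨ ℚᵘ.drop-*<* (ℚᵘ.<-respˡ-≃
                                                 (ℚ.toℚᵘ-fromℚᵘ (mkℚᵘ (+ (2 · length es)) (length xs))) (ℚ.toℚᵘ-mono-< avg<)) ⟩
    + 70 ℤ.* + suc (length xs)              ≡⟨ ℤₚ.pos-* 70 (suc (length xs)) ⟨
    + (70 · suc (length xs))                ∎)
  where open ℤₚ.≤-Reasoning

-- The subgraph to compare with `mad G` consists of the non-isolated vertices of G′ and all its
-- edges.
sparse-subgraph : ∀ {n} {G G′ : Graph n} → mad G < (+ 2 / 1) + (+ 12 / 29) → G′ ⊆ᴳ G → Sparse G′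
sparse-subgraph {n} {G} {G′} mad< sub {u} {v} uv =
    subst (λ d → 29 · d ≺ 70 · nonIsolated G′) (handshake G′)
      (subst (λ k → 29 · (2 · length (edges G′)) ≺ 70 · k) size
        (averageDegree-< vs (edges G′) (non-isolated uv) (ℚ.≤-<-trans below mad<)))
  where
    non-isolated? : Decidable₁ (λ v → 1 ≤ degree G′ v)
    non-isolated? v = 1 ℕ.≤? degree G′ v
    vs = filter non-isolated? (allFin n)
    non-isolated : ∀ {a b} → Adj G′ a b → a ∈ vs
    non-isolated {a} {b} ab = ∈-filter⁺ non-isolated? (∈-allFin a) (nonempty (∈-nbrs⁺ G′ ab))
      where
        nonempty : ∀ {xs : List (Fin n)} → b ∈ xs → 1 ≤ length xs
        nonempty (here _)  = s≤s z≤n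
        nonempty (there _) = s≤s z≤n
    indicator : ∀ d → 𝟙 (1 ℕ.≤? d) ≡ positive d
    indicator zero    = refl
    indicator (suc d) = refl
    size : length vs ≡ nonIsolated G′
    size = trans (length-filter-∑ non-isolated? (allFin n)) (∑-cong (allFin n) (λ v → indicator (degree G′ v)))
    closed : Closed (vs , edges G′)
    closed = All.tabulate λ {e} e∈ →
      let a = proj₂ (proj₂ (∈-filter⁻ (forward? G′) {xs = cartesianProduct (allFin n) (allFin n)} e∈))
      in non-isolated a , non-isolated (symAdj G′ a)
    member : (vs , edges G′) ∈ subgraphs G
    member = ∈-filter⁺ closed? (∈-cartesianProduct⁺ (filter-∈-sublists non-isolated? (allFin n))
      (∈-sublists-filter (forward? G′) (forward? G) (λ (p , a) → p , sub a) (cartesianProduct (allFin n) (allFin n)))) closed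
    below : averageDegree (vs , edges G′) ≤ℚ mad G
    below = All.lookup (xs≤maxℚ _ (map averageDegree (subgraphs G))) (∈-map⁺ averageDegree member)

-- Decidability of choosability, and the choice number

least : ∀ {P : ℕ → Set} → Decidable₁ P → ∀ m → P m → ∃ λ k → (P k × (∀ j → P j → k ≤ j)) × k ≤ m
least P? m p with P? 0
... | yes p₀ = 0 , (p₀ , λ _ _ → z≤n) , z≤n
least P? zero    p | no ¬p₀ = contradiction p ¬p₀
least P? (suc m) p | no ¬p₀ with least (P? ∘ suc) m p
... | k , (pk , k-least) , k≤m = suc k , (pk , λ { zero p₀ → contradiction p₀ ¬p₀ ; (suc j) pj → s≤s (k-least j pj) }) , s≤s k≤m

lookup-injective : ∀ {xs : List X} → Unique xs → ∀ i j → lookup xs i ≡ lookup xs j → i ≡ j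
lookup-injective (_ ∷ _)  zero    zero    _  = refl
lookup-injective (x∉ ∷ _) zero    (suc j) eq = contradiction eq (All.lookup x∉ (∈-lookup j))
lookup-injective (x∉ ∷ _) (suc i) zero    eq = contradiction (sym eq) (All.lookup x∉ (∈-lookup i))
lookup-injective (_ ∷ u)  (suc i) (suc j) eq = cong suc (lookup-injective u i j eq)

-- Only lists of exactly j colors matter, and up to renaming there are at most
-- n j colors; hence choosability is decidable.
module _ {n : ℕ} (H : Graph n) (j : ℕ) where

  Lists : Set
  Lists = Fin n → Fin j → ℕ

  Injective : Lists → Set
  Injective e = ∀ v {i k} → e v i ≡ e v k → i ≡ k

  Selectable : Lists → Set
  Selectable e = ∃ λ (s : Fin n → Fin j) → ∀ u v → Adj H u v → e u (s u) ≢ e v (s v)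

  selectable? : ∀ e → Dec (Selectable e)
  selectable? e = map′
    (λ (i , proper) → finToFun i , proper)
    (λ (s , proper) → funToFin s , λ u v uv eq → proper u v uv
      (trans (cong (e u) (sym (Finₚ.finToFun-funToFin s u))) (trans eq (cong (e v) (Finₚ.finToFun-funToFin s v)))))
    (any? λ i → all? λ u → all? λ v → adj? H u v →-dec ¬? (e u (finToFun i u) ℕ.≟ e v (finToFun i v)))

  LColoring⇒Selectable : ∀ e → LColoring H (λ v → tabulate (e v)) → Selectable e
  LColoring⇒Selectable e (c , c∈ , c≢) = (λ v → proj₁ (∈-tabulate⁻ (c∈ v))) , λ u v uv eq →
    c≢ uv (trans (proj₂ (∈-tabulate⁻ (c∈ u))) (trans eq (sym (proj₂ (∈-tabulate⁻ (c∈ v))))))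

  Choosable⇒Selectable : Choosable H j → ∀ e → Injective e → Selectable e
  Choosable⇒Selectable ch e inj = LColoring⇒Selectable e (ch (λ v → tabulate (e v))
    (λ v → Unique.tabulate⁺ (inj v)) (λ v → ℕ.≤-reflexive (sym (length-tabulate (e v)))))

  Selectable⇒Choosable : (∀ e → Injective e → Selectable e) → Choosable H j
  Selectable⇒Choosable sel L L-unique L-length
    with sel (λ v i → lookup (L v) (Fin.inject≤ i (L-length v)))
             (λ v eq → Finₚ.inject≤-injective _ _ _ _ (lookup-injective (L-unique v) _ _ eq))
  ... | s , proper = (λ v → lookup (L v) (Fin.inject≤ (s v) (L-length v))) ,
                     (λ v → ∈-lookup _) , λ {u} {v} uv → proper u v uv

  Coded : (Fin (n · j) → Fin (n · j)) → Lists
  Coded f v i = Fin.toℕ (f (combine v i))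

  CodedSelectable : Set
  CodedSelectable = ∀ (i : Fin ((n · j) ^ (n · j))) →
    (∀ v (a b : Fin j) → Coded (finToFun i) v a ≡ Coded (finToFun i) v b → a ≡ b) → Selectable (Coded (finToFun i))

  coded? : Dec CodedSelectable
  coded? = all? λ i → (all? λ v → all? λ a → all? λ b →
    (Coded (finToFun i) v a ℕ.≟ Coded (finToFun i) v b) →-dec (a ≟ b)) →-dec selectable? (Coded (finToFun i))

  module _ (e : Lists) (inj : Injective e) where

    color : Fin (n · j) → ℕ
    color p = let v , i = remQuot {n} j p in e v i

    color-combine : ∀ v i → color (combine v i) ≡ e v i
    color-combine v i = cong (λ (v , i) → e v i) (Finₚ.remQuot-combine v i)

    -- A color is renamed to a slot of the lists that holds it. The slot depends on the color alone,
    -- so equal colors get equal names; the default is never reached for a color in use.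
    representative : ℕ → Fin (n · j) → Fin (n · j)
    representative c default with any? (λ q → color q ℕ.≟ c)
    ... | yes (q , _) = q
    ... | no _        = default

    rename : Fin (n · j) → Fin (n · j)
    rename p = representative (color p) p

    color-rename : ∀ p → color (rename p) ≡ color p
    color-rename p with any? (λ q → color q ℕ.≟ color p)
    ... | yes (_ , eq) = eq
    ... | no none      = contradiction (p , refl) none

    representative-cong : ∀ {c} p q → color p ≡ c → representative c p ≡ representative c q
    representative-cong {c} p q eq with any? (λ q → color q ℕ.≟ c)
    ... | yes _   = refl
    ... | no none = contradiction (p , eq) none

    rename-cong : ∀ p q → color p ≡ color q → rename p ≡ rename q
    rename-cong p q eq = trans (cong (λ c → representative c p) eq) (representative-cong p q eq)

    -- `CodedSelectable` speaks of functions of the form `finToFun i`, and this one agrees with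
    -- `rename` only pointwise.
    code : Fin (n · j) → Fin (n · j)
    code = finToFun (funToFin rename)

    code-rename : ∀ p → code p ≡ rename p
    code-rename = Finₚ.finToFun-funToFin rename

    code-color : ∀ {p q} → code p ≡ code q → color p ≡ color q
    code-color {p} {q} eq = trans (sym (color-rename p)) (trans
      (cong color (trans (sym (code-rename p)) (trans eq (code-rename q)))) (color-rename q))

    color-code : ∀ {p q} → color p ≡ color q → code p ≡ code q
    color-code {p} {q} eq = trans (code-rename p) (trans (rename-cong p q eq) (sym (code-rename q)))

    decode : CodedSelectable → Selectable e
    decode coded with coded (funToFin rename) (λ v a b eq → inj v (trans (sym (color-combine v a))
                        (trans (code-color (Finₚ.toℕ-injective eq)) (color-combine v b))))
    ... | s , proper = s , λ u v uv eq → proper u v uv (cong Fin.toℕ (color-code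
          (trans (color-combine u (s u)) (trans eq (sym (color-combine v (s v)))))))

  choosable? : Dec (Choosable H j)
  choosable? = map′ (λ coded → Selectable⇒Choosable λ e inj → decode e inj coded)
    (λ ch i inj → Choosable⇒Selectable ch (Coded (finToFun i)) (λ v → inj v _ _)) coded?

theorem4 : ∀ (n : ℕ) (G : Graph n) →
    Δ G ≤ 5 →
    mad G < (+ 2 / 1) + (+ 12 / 29) →
    ∃ λ (k : ℕ) → IsChoiceNumber (square G) k × k ≤ 6
theorem4 n G Δ≤5 mad< = least (choosable? (square G)) 6
  (Selectable⇒Choosable (square G) 6 λ e inj → decidable-stable (selectable? (square G) 6 e) λ ¬sel →
    ¬¬colorable (λ v → tabulate (e v)) (λ v → Unique.tabulate⁺ (inj v))
      (λ v → ℕ.≤-reflexive (sym (length-tabulate (e v))))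
      (suc (totalDegree G)) G ℕ.≤-refl degree≤5 (λ {G′} sub {u} {v} → sparse-subgraph {G = G} {G′} mad< sub {u} {v})
      (¬sel ∘ LColoring⇒Selectable (square G) 6 e))
  where
    degree≤5 : ∀ v → degree G v ≤ 5
    degree≤5 v = ℕ.≤-trans (All.lookup (xs≤maxℕ 0 (map (degree G) (allFin n))) (∈-map⁺ (degree G) (∈-allFin v))) Δ≤5
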